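{- Let $\mathcal{R}$ be a finite valuation ring of order $q^r$, let $d\ge 1$ and $k\ge 1$ be integers, and let $\mathcal{E}\subseteq \mathcal{R}^d$. Suppose that \[|\mathcal{E}|\gg q^{\frac{(d-1)(2r-1)+r(k+1)}{2}}.\] Then the number of dot-product congruence classes of $k$-simplices in $\mathcal{E}$ is at least $(1-o(1))q^{r\binom{k+1}{2}}$.
   Context: Throughout, $\mathcal{R}$ is a finite valuation ring: a finite commutative local ring with identity whose ideals are totally ordered by inclusion (a finite chain ring); its residue field has $q$ elements, $q=p^n$ an odd prime power, and $|\mathcal{R}|=q^r$. $\mathcal{R}^*$ denotes the units and $\mathcal{R}^0$ the non-units (the maximal ideal). For $\mathbf{x},\mathbf{y}\in\mathcal{R}^d$, $\mathbf{x}\cdot\mathbf{y}=x_1y_1+\cdots+x_dy_d$. A $k$-simplex in $\mathcal{E}$ is an ordered $(k+1)$-tuple $(\mathbf{x}_1,\ldots,\mathbf{x}_{k+1})$ of points of $\mathcal{E}$; two $k$-simplices $(\mathbf{x}_1,\ldots,\mathbf{x}_{k+1})$ and $(\mathbf{y}_1,\ldots,\mathbf{y}_{k+1})$ are in the same dot-product congruence class if $\mathbf{x}_i\cdot\mathbf{x}_j=\mathbf{y}_i\cdot\mathbf{y}_j$ for all $1\le i,j\le k+1$. Notation: $X\ll Y$ (equivalently $Y\gg X$) means there is a constant $C>0$ with $X\le CY$; $o(1)$ denotes a quantity tending to $0$ as $q\to\infty$. -}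

module Defs where

open import Level using (0ℓ)
open import Algebra.Bundles using (CommutativeRing)
open import Data.Nat using (ℕ; zero; suc)
open import Data.Fin using (Fin) renaming (_<_ to _<ᶠ_)
open import Data.Fin.Properties using (any?; all?) renaming (_<?_ to _<ᶠ?_)
open import Data.List using (List; []; _∷_; length; filter; map; concatMap; allFin; deduplicate)
open import Data.List.Relation.Unary.AllPairs using (AllPairs)
open import Data.Vec using (Vec; []; _∷_; zipWith; foldr; lookup; tabulate)
open import Data.Vec.Relation.Binary.Pointwise.Inductive as PW using (Pointwise)
open import Data.Product using (Σ; ∃; _×_; _,_)
open import Data.Sum using (_⊎_)
open import Relation.Nullary using (¬_; Dec; yes; no; ¬?)
open import Relation.Nullary.Decidable using (_→-dec_)
open import Relation.Binary.PropositionalEquality using (_≡_)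
open import Relation.Binary using (Decidable)
open import Relation.Unary using (Pred; _⊆_)

record Ideal (R : CommutativeRing 0ℓ 0ℓ) : Set₁ where
  open CommutativeRing R
  field
    member   : Pred Carrier 0ℓ
    resp-≈   : ∀ {x y} → x ≈ y → member x → member y
    has-0    : member 0#
    closed-+ : ∀ {x y} → member x → member y → member (x + y)
    closed-* : ∀ r {x} → member x → member (r * x)

module _ (R : CommutativeRing 0ℓ 0ℓ) where
  open CommutativeRing R
  IsUnit : Carrier → Set
  IsUnit x = ∃ λ y → x * y ≈ 1#

record FiniteValuationRing : Set₁ where
  field
    cring : CommutativeRing 0ℓ 0ℓ
  open CommutativeRing cring public hiding (ring)
  field
    _≟_        : Decidable _≈_
    size       : ℕ
    enum       : Fin size → Carrier
    enum-inj   : ∀ i j → enum i ≈ enum j → i ≡ j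
    enum-surj  : ∀ x → ∃ λ i → enum i ≈ x
    nontrivial : ¬ (1# ≈ 0#)
    local      : ∀ x y → ¬ IsUnit cring x → ¬ IsUnit cring y → ¬ IsUnit cring (x + y)
    chain      : (I J : Ideal cring) →
                 (Ideal.member I ⊆ Ideal.member J) ⊎ (Ideal.member J ⊆ Ideal.member I)

  isUnit? : ∀ x → Dec (IsUnit cring x)
  isUnit? x with any? (λ j → (x * enum j) ≟ 1#)
  ... | yes (j , p) = yes (enum j , p)
  ... | no ¬p = no λ { (y , q) → ¬p (Σ-elim y q) }
    where
    Σ-elim : ∀ y → x * y ≈ 1# → ∃ λ j → x * enum j ≈ 1#
    Σ-elim y q with enum-surj y
    ... | (j , ej≈y) = j , trans (*-congˡ ej≈y) q

  -- residue field R/𝔪 (𝔪 = non-units): its cardinality is the number of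
  -- cosets x + 𝔪; we count one representative per coset, namely the
  -- enumeration index i such that enum i - enum j is a unit for all j < i.
  residueCard : ℕ
  residueCard = length (filter (λ i → all? (λ j → (j <ᶠ? i) →-dec isUnit? (enum i - enum j)))
                                (allFin size))

  _·_ : ∀ {d} → Vec Carrier d → Vec Carrier d → Carrier
  x · y = foldr _ _+_ 0# (zipWith _*_ x y)

  gram : ∀ {d m} → Vec (Vec Carrier d) m → Vec (Vec Carrier m) m
  gram xs = tabulate λ i → tabulate λ j → lookup xs i · lookup xs j

  GramEq : ∀ {m} → Vec (Vec Carrier m) m → Vec (Vec Carrier m) m → Set
  GramEq = Pointwise (Pointwise _≈_)

  gramEq? : ∀ {m} → Decidable (GramEq {m})
  gramEq? = PW.decidable (PW.decidable _≟_)

  PointEq : ∀ {d} → Vec Carrier d → Vec Carrier d → Set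
  PointEq = Pointwise _≈_

tuples : ∀ {A : Set} (m : ℕ) → List A → List (Vec A m)
tuples zero    xs = [] ∷ []
tuples (suc m) xs = concatMap (λ x → map (x ∷_) (tuples m xs)) xs

module _ (R : FiniteValuationRing) where
  open FiniteValuationRing R

  IsFinSet : ∀ {d} → List (Vec Carrier d) → Set
  IsFinSet E = AllPairs (λ x y → ¬ PointEq x y) E

  -- number of dot-product congruence classes of k-simplices in E
  -- (k-simplex = ordered (k+1)-tuple of points of E; two are congruent
  -- iff all pairwise dot products agree)
  numClasses : ∀ {d} (k : ℕ) → List (Vec Carrier d) → ℕ
  numClasses k E = length (deduplicate gramEq? (map gram (tuples (suc k) E)))

{-# OPTIONS --safe #-}
-- The points x₁, x₂, … of the simplices are chosen one at a time. Suppose x₁, …, xⱼ are chosen and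
-- Eᵢ is the set of candidates for the i-th point, all having the prescribed dot products with
-- x₁, …, xⱼ. For a prescribed value t, the number of y ∈ Eᵢ with x · y = t is at least |Eᵢ| / 2|R| for
-- all but a few of the candidates x for xⱼ₊₁, by a second moment computation over all x ∈ Rᵈ having
-- the right dot products with x₁, …, xⱼ. Two points y, y′ ∈ Eᵢ are uncorrelated up to the factor
-- |Ann (y′ - y)|, provided that the Gram matrix of x₁, …, xⱼ bordered by the prescribed dot products of
-- xⱼ₊₁ and of xᵢ, with corner t, is invertible over the residue field. This excludes at most one
-- residue class of t. Demanding it of the matrix and of its transpose also keeps the Gram matrix bordered
-- by one column of full rank, whatever the uncontrolled diagonal entries x · x are. So at most two of
-- the q residue classes are lost for each of the (k+1 choose 2) dot products.
module Submission where

open import Defs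
open import Level using (0ℓ)
open import Algebra.Bundles using (CommutativeRing)
open import Data.Nat using (ℕ; zero; suc; _+_; _*_; _^_; _∸_; _≤_; _<_; _≤?_; _%_; z≤n; s≤s; >-nonZero)
import Data.Nat.Properties as ℕₚ
open ℕₚ using (*-cancelˡ-≡; *-cancelˡ-≤; *-distribʳ-∸; *-distribˡ-+; *-mono-≤; *-monoʳ-≤; *-monoˡ-≤; *-zeroʳ; +-cancelʳ-≤; +-mono-≤; +-monoʳ-≤; 1+n≢0; <-irrefl; <⇒≤; ^-*-assoc; ^-distribˡ-+-*; ^-monoʳ-≤; ^-monoˡ-≤; m<m*n; m^n>0; m≤m*n; m≤m+n; m≤n*m; m≤n+m; n≢0⇒n>0; ≤-antisym; ≤-refl; ≤-reflexive; ≤-trans; module ≤-Reasoning)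
open import Data.Nat.Combinatorics using (_C_; nC1≡n; nCk+nC[k+1]≡[n+1]C[k+1])
open import Data.Nat.Primality using (Prime)
open import Data.Nat.Solver using (module +-*-Solver)
open import Data.Fin using (Fin; zero; suc; inject; fromℕ<) renaming (_<_ to _<ᶠ_)
open import Data.Fin.Properties using (any?; all?; ¬∀⟶∃¬; ¬∀⟶∃¬-smallest; <-cmp; toℕ-fromℕ<; toℕ-inject; toℕ-injective) renaming (_<?_ to _<ᶠ?_)
open import Data.List using (List; []; _∷_; length; filter; map; concatMap; _++_; allFin; deduplicate)
open import Data.List.Properties using (length-map; length-tabulate; length-++)
open import Data.List.Membership.Propositional using (_∈_; find)
open import Data.List.Membership.Propositional.Properties using (∈-allFin; ∈-filter⁺; ∈-filter⁻; ∈-map⁺; ∈-concatMap⁺)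
open import Data.List.Relation.Unary.Any as Any using (here; there)
import Data.List.Relation.Unary.Any.Properties as AnyP
open import Data.List.Relation.Unary.All as All using (All; []; _∷_)
import Data.List.Relation.Unary.All.Properties as AllP
open import Data.List.Relation.Unary.AllPairs as AllPairs using (AllPairs; []; _∷_)
import Data.List.Relation.Unary.AllPairs.Properties as AllPairsP
open import Data.List.Relation.Unary.Unique.Propositional.Properties using (allFin⁺)
open import Data.Vec as Vec using (Vec; []; _∷_; zipWith; foldr; replicate; lookup)
import Data.Vec.Properties as VecP
open import Data.Vec.Relation.Binary.Pointwise.Inductive as PW using (Pointwise; []; _∷_)
open import Data.Product using (∃; _×_; _,_; proj₁; proj₂)
open import Data.Sum using (_⊎_; inj₁; inj₂)
open import Data.Empty using (⊥-elim)
open import Function using (_∘_; case_of_)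
open import Relation.Nullary using (¬_; Dec; yes; no; ¬?)
open import Relation.Nullary.Decidable using (_→-dec_; _×-dec_; map′)
open import Relation.Unary using () renaming (Decidable to Decidable₁)
open import Relation.Binary using (Rel; IsEquivalence; tri<; tri≈; tri>) renaming (Decidable to Decidable₂)
import Relation.Binary.Reasoning.Setoid as SetoidReasoning
open import Relation.Binary.PropositionalEquality using (_≡_; refl; sym; trans; cong; cong₂; subst; subst₂; module ≡-Reasoning)

-- The obstacle is that R has zero divisors: x · (y′ - y) is spread evenly only over the ideal
-- generated by the coordinates of y′ - y. The excess in the second moment is `torsion d`, the sum
-- of |Ann s|^d over s ≠ 0. For d ≥ 2 it is at most 2 q μ^d, where μ is the size of the maximal
-- ideal; for d = 1 no set can be as large as the hypothesis demands. Exact equidistribution also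
-- needs candidates that are independent of the chosen points modulo the maximal ideal. The full
-- rank of the bordered Gram matrix forces the dependent ones into a single residue class of Rᵈ,
-- which is at most half of the set. With the factor 2|R| of the second moment, a step costs 4|R|,
-- so after j steps |E| / (4|R|)^j candidates remain. Chebyshev's inequality wants the product of
-- two such sizes to dominate |R|^(d-j) q μ^d, that is, |E|² to dominate 16^j |R|^(d+j) q μ^d. The
-- last step, j = k - 1, gives the exponent of the theorem.

-- Iverson brackets and finite sums over lists

⟨_⟩ : {P : Set} → Dec P → ℕ
⟨ yes _ ⟩ = 1
⟨ no  _ ⟩ = 0

⟨⟩-yes : {P : Set} (P? : Dec P) → P → ⟨ P? ⟩ ≡ 1
⟨⟩-yes (yes _)  _ = refl
⟨⟩-yes (no ¬p) p = ⊥-elim (¬p p)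

⟨⟩-no : {P : Set} (P? : Dec P) → ¬ P → ⟨ P? ⟩ ≡ 0
⟨⟩-no (yes p) ¬p = ⊥-elim (¬p p)
⟨⟩-no (no _)  _  = refl

⟨⟩-mono : {P Q : Set} (P? : Dec P) (Q? : Dec Q) → (P → Q) → ⟨ P? ⟩ ≤ ⟨ Q? ⟩
⟨⟩-mono (yes p) Q? f = ≤-reflexive (sym (⟨⟩-yes Q? (f p)))
⟨⟩-mono (no _)  Q? f = z≤n

⟨⟩-cong : {P Q : Set} (P? : Dec P) (Q? : Dec Q) → (P → Q) → (Q → P) → ⟨ P? ⟩ ≡ ⟨ Q? ⟩
⟨⟩-cong P? Q? f g = ≤-antisym (⟨⟩-mono P? Q? f) (⟨⟩-mono Q? P? g)

⟨⟩-≤1 : {P : Set} (P? : Dec P) → ⟨ P? ⟩ ≤ 1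
⟨⟩-≤1 (yes _) = ≤-refl
⟨⟩-≤1 (no _)  = z≤n

∑ : {A : Set} → List A → (A → ℕ) → ℕ
∑ []       f = 0
∑ (x ∷ xs) f = f x + ∑ xs f

infix 5 ∑
syntax ∑ L (λ x → e) = ∑[ x ∈ L ] e

module _ {A : Set} where

  ∑-mono-∈ : (L : List A) {f g : A → ℕ} → (∀ {x} → x ∈ L → f x ≤ g x) → ∑ L f ≤ ∑ L g
  ∑-mono-∈ []      h = z≤n
  ∑-mono-∈ (x ∷ L) h = +-mono-≤ (h (here refl)) (∑-mono-∈ L (h ∘ there))

  ∑-mono : (L : List A) {f g : A → ℕ} → (∀ x → f x ≤ g x) → ∑ L f ≤ ∑ L g
  ∑-mono L h = ∑-mono-∈ L (λ {x} _ → h x)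

  ∑-cong-∈ : (L : List A) {f g : A → ℕ} → (∀ {x} → x ∈ L → f x ≡ g x) → ∑ L f ≡ ∑ L g
  ∑-cong-∈ []      h = refl
  ∑-cong-∈ (x ∷ L) h = cong₂ _+_ (h (here refl)) (∑-cong-∈ L (h ∘ there))

  ∑-cong : (L : List A) {f g : A → ℕ} → (∀ x → f x ≡ g x) → ∑ L f ≡ ∑ L g
  ∑-cong L h = ∑-cong-∈ L (λ {x} _ → h x)

  ∑-+ : (L : List A) (f g : A → ℕ) → ∑[ x ∈ L ] (f x + g x) ≡ ∑ L f + ∑ L g
  ∑-+ []      f g = refl
  ∑-+ (x ∷ L) f g = trans (cong (f x + g x +_) (∑-+ L f g))
    (solve 4 (λ a b c d → (a :+ b) :+ (c :+ d) := (a :+ c) :+ (b :+ d)) refl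
      (f x) (g x) (∑ L f) (∑ L g))
    where open +-*-Solver

  ∑-*ˡ : (L : List A) (c : ℕ) (f : A → ℕ) → ∑[ x ∈ L ] (c * f x) ≡ c * ∑ L f
  ∑-*ˡ []      c f = sym (*-zeroʳ c)
  ∑-*ˡ (x ∷ L) c f = trans (cong (c * f x +_) (∑-*ˡ L c f)) (sym (*-distribˡ-+ c (f x) _))

  ∑-*ʳ : (L : List A) (c : ℕ) (f : A → ℕ) → ∑[ x ∈ L ] (f x * c) ≡ ∑ L f * c
  ∑-*ʳ L c f = trans (∑-cong L (λ x → ℕₚ.*-comm (f x) c)) (trans (∑-*ˡ L c f) (ℕₚ.*-comm c _))

  ∑-const : (L : List A) (c : ℕ) → ∑[ _ ∈ L ] c ≡ length L * c
  ∑-const []      c = refl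
  ∑-const (x ∷ L) c = cong (c +_) (∑-const L c)

  ∑-zero : (L : List A) {f : A → ℕ} → (∀ {x} → x ∈ L → f x ≡ 0) → ∑ L f ≡ 0
  ∑-zero L h = trans (∑-cong-∈ L h) (trans (∑-const L 0) (*-zeroʳ (length L)))

  ∑-++ : (L M : List A) (f : A → ℕ) → ∑ (L ++ M) f ≡ ∑ L f + ∑ M f
  ∑-++ []      M f = refl
  ∑-++ (x ∷ L) M f = trans (cong (f x +_) (∑-++ L M f)) (sym (ℕₚ.+-assoc (f x) _ _))

  ∑-filter : {P : A → Set} (P? : Decidable₁ P) (L : List A) (f : A → ℕ) →
             ∑ (filter P? L) f ≡ ∑[ x ∈ L ] (⟨ P? x ⟩ * f x)
  ∑-filter P? []      f = refl
  ∑-filter P? (x ∷ L) f with P? x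
  ... | yes _ = cong₂ _+_ (sym (ℕₚ.+-identityʳ _)) (∑-filter P? L f)
  ... | no _  = ∑-filter P? L f

  length-filter-∑ : {P : A → Set} (P? : Decidable₁ P) (L : List A) →
                    length (filter P? L) ≡ ∑[ x ∈ L ] ⟨ P? x ⟩
  length-filter-∑ P? []      = refl
  length-filter-∑ P? (x ∷ L) with P? x
  ... | yes _ = cong suc (length-filter-∑ P? L)
  ... | no _  = length-filter-∑ P? L

  ∑-pos⇒∃ : (L : List A) (f : A → ℕ) → ¬ (∑ L f ≡ 0) → ∃ λ x → x ∈ L × ¬ (f x ≡ 0)
  ∑-pos⇒∃ []      f h = ⊥-elim (h refl)
  ∑-pos⇒∃ (x ∷ L) f h with f x in eq
  ... | suc _ = x , here refl , λ fx≡0 → 1+n≢0 (trans (sym eq) fx≡0)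
  ... | zero with ∑-pos⇒∃ L f h
  ...   | y , y∈L , fy = y , there y∈L , fy

  ∑-∈-≤ : {L : List A} (f : A → ℕ) {x : A} → x ∈ L → f x ≤ ∑ L f
  ∑-∈-≤ {L = y ∷ L} f (here refl) = m≤m+n (f y) _
  ∑-∈-≤ {L = y ∷ L} f (there x∈L) = ≤-trans (∑-∈-≤ f x∈L) (m≤n+m _ (f y))

  ∑⟨⟩≤1 : {_#_ : Rel A 0ℓ} {P : A → Set} (P? : Decidable₁ P) {L : List A} → AllPairs _#_ L →
          (∀ {x y} → P x → P y → ¬ x # y) → ∑[ x ∈ L ] ⟨ P? x ⟩ ≤ 1
  ∑⟨⟩≤1 P? [] h = z≤n
  ∑⟨⟩≤1 P? {x ∷ L} (px ∷ pL) h with P? x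
  ... | no _   = ∑⟨⟩≤1 P? pL h
  ... | yes Px = ≤-reflexive (cong suc
        (∑-zero L (λ {y} y∈L → ⟨⟩-no (P? y) (λ Py → h Px Py (All.lookup px y∈L)))))

module _ {A B : Set} where

  ∑-swap : (L : List A) (M : List B) (f : A → B → ℕ) →
           ∑[ x ∈ L ] ∑[ y ∈ M ] f x y ≡ ∑[ y ∈ M ] ∑[ x ∈ L ] f x y
  ∑-swap []      M f = sym (∑-zero M (λ _ → refl))
  ∑-swap (x ∷ L) M f = trans (cong (∑ M (f x) +_) (∑-swap L M f)) (sym (∑-+ M (f x) _))

  ∑-product : (L : List A) (M : List B) (f : A → ℕ) (g : B → ℕ) →
              ∑[ x ∈ L ] ∑[ y ∈ M ] (f x * g y) ≡ ∑ L f * ∑ M g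
  ∑-product L M f g = trans (∑-cong L (λ x → ∑-*ˡ M (f x) g)) (∑-*ʳ L (∑ M g) f)

  ∑-map : (h : A → B) (L : List A) (f : B → ℕ) → ∑ (map h L) f ≡ ∑ L (f ∘ h)
  ∑-map h []      f = refl
  ∑-map h (x ∷ L) f = cong (f (h x) +_) (∑-map h L f)

  ∑-concatMap : (h : A → List B) (L : List A) (f : B → ℕ) →
                ∑ (concatMap h L) f ≡ ∑[ x ∈ L ] ∑ (h x) f
  ∑-concatMap h []      f = refl
  ∑-concatMap h (x ∷ L) f = trans (∑-++ (h x) _ f) (cong (∑ (h x) f +_) (∑-concatMap h L f))

∑-tuples : {A : Set} (d : ℕ) (L : List A) (f : Vec A (suc d) → ℕ) →
           ∑ (tuples (suc d) L) f ≡ ∑[ x ∈ L ] ∑[ v ∈ tuples d L ] f (x ∷ v)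
∑-tuples d L f = trans (∑-concatMap _ L f) (∑-cong L (λ x → ∑-map (x ∷_) (tuples d L) f))

-- Sums over a type enumerated up to an equivalence

module Enumeration {A : Set} {_≈_ : Rel A 0ℓ} (isEquivalence : IsEquivalence _≈_)
                   (_≟_ : Decidable₂ _≈_) where
  open IsEquivalence isEquivalence renaming (refl to ≈-refl; sym to ≈-sym; trans to ≈-trans)

  -- Elements are listed only up to `≈`, so "exactly once" is a count of matches; it then acts as a
  -- delta function inside sums.
  IsEnum : List A → Set
  IsEnum U = ∀ v → ∑[ u ∈ U ] ⟨ v ≟ u ⟩ ≡ 1

  Respects : (A → ℕ) → Set
  Respects f = ∀ {x y} → x ≈ y → f x ≡ f y

  ⟨≟⟩*-subst : {f : A → ℕ} → Respects f → ∀ x y → ⟨ x ≟ y ⟩ * f x ≡ ⟨ x ≟ y ⟩ * f y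
  ⟨≟⟩*-subst rf x y with x ≟ y
  ... | yes x≈y = cong (1 *_) (rf x≈y)
  ... | no _    = refl

  module _ (U : List A) (enum : IsEnum U) where

    ∑-δ : {f : A → ℕ} → Respects f → ∀ v → f v ≡ ∑[ u ∈ U ] (⟨ v ≟ u ⟩ * f u)
    ∑-δ {f} rf v = begin
      f v                            ≡⟨ ℕₚ.*-identityˡ (f v) ⟨
      1 * f v                        ≡⟨ cong (_* f v) (enum v) ⟨
      ∑ U (λ u → ⟨ v ≟ u ⟩) * f v    ≡⟨ ∑-*ʳ U (f v) _ ⟨
      ∑[ u ∈ U ] (⟨ v ≟ u ⟩ * f v)   ≡⟨ ∑-cong U (⟨≟⟩*-subst rf v) ⟩
      ∑[ u ∈ U ] (⟨ v ≟ u ⟩ * f u)   ∎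
      where open ≡-Reasoning

    ∑-expand : {f : A → ℕ} → Respects f → {B : Set} (L : List B) (φ : B → A) →
               ∑[ x ∈ L ] f (φ x) ≡ ∑[ u ∈ U ] (∑ L (λ x → ⟨ φ x ≟ u ⟩) * f u)
    ∑-expand {f} rf L φ = begin
      ∑[ x ∈ L ] f (φ x)                            ≡⟨ ∑-cong L (λ x → ∑-δ rf (φ x)) ⟩
      ∑[ x ∈ L ] ∑[ u ∈ U ] (⟨ φ x ≟ u ⟩ * f u)     ≡⟨ ∑-swap L U _ ⟩
      ∑[ u ∈ U ] ∑[ x ∈ L ] (⟨ φ x ≟ u ⟩ * f u)     ≡⟨ ∑-cong U (λ u → ∑-*ʳ L (f u) _) ⟩
      ∑[ u ∈ U ] (∑ L (λ x → ⟨ φ x ≟ u ⟩) * f u)    ∎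
      where open ≡-Reasoning

    -- The two implications identify the fibre of `φ` over `u` with the class of `ψ u`, which an
    -- enumeration meets once.
    ∑-reindex : {f : A → ℕ} → Respects f → (φ ψ : A → A) →
                (∀ {x u} → φ x ≈ u → ψ u ≈ x) → (∀ {x u} → ψ u ≈ x → φ x ≈ u) →
                ∑[ x ∈ U ] f (φ x) ≡ ∑ U f
    ∑-reindex {f} rf φ ψ φ⇒ψ ψ⇒φ = trans (∑-expand rf U φ) (∑-cong U λ u →
      trans (cong (_* f u) (trans
              (∑-cong U (λ x → ⟨⟩-cong (φ x ≟ u) (ψ u ≟ x) φ⇒ψ ψ⇒φ)) (enum (ψ u))))
            (ℕₚ.*-identityˡ (f u)))

    ∑-distinct-≤ : {f : A → ℕ} → Respects f → {B : List A} → AllPairs (λ x y → ¬ x ≈ y) B →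
                   ∑ B f ≤ ∑ U f
    ∑-distinct-≤ {f} rf {B} B! = ≤-trans (≤-reflexive (∑-expand rf B (λ x → x))) (∑-mono U λ u →
      ≤-trans (*-monoˡ-≤ (f u)
                (∑⟨⟩≤1 (_≟ u) B! (λ x≈u y≈u x≉y → x≉y (≈-trans x≈u (≈-sym y≈u)))))
              (≤-reflexive (ℕₚ.*-identityˡ (f u))))

-- The multiplication principle for objects counted up to a separation relation: objects of one row
-- are separated by assumption, objects of different rows because the rows are.
gather : {A B : Set} {_#_ : Rel A 0ℓ} {_#′_ : Rel B 0ℓ} (Q : A → B → Set) (c : ℕ) →
         (∀ {r r′ b b′} → r # r′ → Q r b → Q r′ b′ → b #′ b′) →
         (rows : List A) → AllPairs _#_ rows →
         (∀ {r} → r ∈ rows → ∃ λ l → All (Q r) l × AllPairs _#′_ l × c ≤ length l) →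
         ∃ λ l → All (λ b → ∃ λ r → r ∈ rows × Q r b) l × AllPairs _#′_ l × length rows * c ≤ length l
gather Q c sep [] [] h = [] , [] , [] , z≤n
gather Q c sep (r ∷ rows) (r# ∷ rows#) h
  with h (here refl) | gather Q c sep rows rows# (h ∘ there)
... | l , Ql , l# , c≤ | l′ , Ql′ , l′# , c′≤ =
  l ++ l′ ,
  AllP.++⁺ (All.map (λ q → r , here refl , q) Ql)
           (All.map (λ (r′ , r′∈ , q) → r′ , there r′∈ , q) Ql′) ,
  AllPairsP.++⁺ l# l′# (All.map (λ q → All.map (λ (r′ , r′∈ , q′) → sep (All.lookup r# r′∈) q q′) Ql′) Ql) ,
  ≤-trans (+-mono-≤ c≤ c′≤) (≤-reflexive (sym (length-++ l)))

-- The number of dot products between n + 1 points, in the order in which they are prescribed: the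
-- first point fixes n of them.
triangle : ℕ → ℕ
triangle zero    = 0
triangle (suc n) = suc n + triangle n

-- Vectors, matrices and bordered Gram matrices over a commutative ring

module Linear (R : CommutativeRing 0ℓ 0ℓ) where
  open CommutativeRing R renaming (_+_ to _⊕_; _*_ to _⊗_; _-_ to _⊖_; refl to ≈-refl; sym to ≈-sym; trans to ≈-trans)
  open import Algebra.Properties.Ring ring public using (-‿distribˡ-*; -‿distribʳ-*; -‿+-comm; -‿involutive; x[y-z]≈xy-xz)
  open import Algebra.Properties.CommutativeSemigroup +-commutativeSemigroup public using (interchange; x∙yz≈y∙xz)
  open import Algebra.Properties.CommutativeSemigroup *-commutativeSemigroup public using () renaming (x∙yz≈y∙xz to x*yz≈y*xz)
  open import Relation.Binary.Reasoning.Setoid setoid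

  infixl 6 _+ᵛ_ _-ᵛ_
  infixr 7 _*ᵛ_
  infix 8 _·_
  infix 4 _≋_

  _·_ : ∀ {d} → Vec Carrier d → Vec Carrier d → Carrier
  x · y = foldr _ _⊕_ 0# (zipWith _⊗_ x y)

  _≋_ : ∀ {d} → Vec Carrier d → Vec Carrier d → Set
  _≋_ = Pointwise _≈_

  _+ᵛ_ _-ᵛ_ : ∀ {d} → Vec Carrier d → Vec Carrier d → Vec Carrier d
  _+ᵛ_ = zipWith _⊕_
  _-ᵛ_ = zipWith _⊖_

  _*ᵛ_ : ∀ {d} → Carrier → Vec Carrier d → Vec Carrier d
  c *ᵛ v = Vec.map (c ⊗_) v

  0ᵛ : ∀ {d} → Vec Carrier d
  0ᵛ = replicate _ 0#

  x-y≈0⇒x≈y : ∀ {x y} → x ⊖ y ≈ 0# → x ≈ y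
  x-y≈0⇒x≈y {x} {y} h = begin
    x               ≈⟨ +-identityʳ x ⟨
    x ⊕ 0#          ≈⟨ +-congˡ (-‿inverseˡ y) ⟨
    x ⊕ (- y ⊕ y)   ≈⟨ +-assoc x (- y) y ⟨
    x ⊖ y ⊕ y       ≈⟨ +-congʳ h ⟩
    0# ⊕ y          ≈⟨ +-identityˡ y ⟩
    y               ∎

  x≈y⇒x-y≈0 : ∀ {x y} → x ≈ y → x ⊖ y ≈ 0#
  x≈y⇒x-y≈0 {x} {y} h = ≈-trans (+-congʳ h) (-‿inverseʳ y)

  x+y-y≈x : ∀ x y → x ⊕ y ⊖ y ≈ x
  x+y-y≈x x y = ≈-trans (+-assoc x y (- y)) (≈-trans (+-congˡ (-‿inverseʳ y)) (+-identityʳ x))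

  x-y+y≈x : ∀ x y → x ⊖ y ⊕ y ≈ x
  x-y+y≈x x y = ≈-trans (+-assoc x (- y) y) (≈-trans (+-congˡ (-‿inverseˡ y)) (+-identityʳ x))

  0-0≈0 : 0# ⊖ 0# ≈ 0#
  0-0≈0 = -‿inverseʳ 0#

  -‿interchange : ∀ a b c d → (a ⊕ b) ⊖ (c ⊕ d) ≈ (a ⊖ c) ⊕ (b ⊖ d)
  -‿interchange a b c d = ≈-trans (+-congˡ (≈-sym (-‿+-comm c d))) (interchange a b (- c) (- d))

  ≋-refl : ∀ {d} {x : Vec Carrier d} → x ≋ x
  ≋-refl = PW.refl ≈-refl

  ≋-sym : ∀ {d} {x y : Vec Carrier d} → x ≋ y → y ≋ x
  ≋-sym = PW.sym ≈-sym

  ≋-trans : ∀ {d} {x y z : Vec Carrier d} → x ≋ y → y ≋ z → x ≋ z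
  ≋-trans = PW.trans ≈-trans

  +ᵛ-cong : ∀ {d} {x x′ y y′ : Vec Carrier d} → x ≋ x′ → y ≋ y′ → x +ᵛ y ≋ x′ +ᵛ y′
  +ᵛ-cong []      []      = []
  +ᵛ-cong (p ∷ P) (q ∷ Q) = +-cong p q ∷ +ᵛ-cong P Q

  -ᵛ-cong : ∀ {d} {x x′ y y′ : Vec Carrier d} → x ≋ x′ → y ≋ y′ → x -ᵛ y ≋ x′ -ᵛ y′
  -ᵛ-cong []      []      = []
  -ᵛ-cong (p ∷ P) (q ∷ Q) = +-cong p (-‿cong q) ∷ -ᵛ-cong P Q

  *ᵛ-cong : ∀ {d} {c c′} {x x′ : Vec Carrier d} → c ≈ c′ → x ≋ x′ → c *ᵛ x ≋ c′ *ᵛ x′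
  *ᵛ-cong h []      = []
  *ᵛ-cong h (p ∷ P) = *-cong h p ∷ *ᵛ-cong h P

  x+y-y≋x : ∀ {d} (x y : Vec Carrier d) → x +ᵛ y -ᵛ y ≋ x
  x+y-y≋x []      []      = []
  x+y-y≋x (a ∷ x) (b ∷ y) = x+y-y≈x a b ∷ x+y-y≋x x y

  x-y+y≋x : ∀ {d} (x y : Vec Carrier d) → x -ᵛ y +ᵛ y ≋ x
  x-y+y≋x []      []      = []
  x-y+y≋x (a ∷ x) (b ∷ y) = x-y+y≈x a b ∷ x-y+y≋x x y

  x-y≋0⇒x≋y : ∀ {d} {x y : Vec Carrier d} → x -ᵛ y ≋ 0ᵛ → x ≋ y
  x-y≋0⇒x≋y {x = []}    {[]}    []      = []
  x-y≋0⇒x≋y {x = _ ∷ _} {_ ∷ _} (p ∷ P) = x-y≈0⇒x≈y p ∷ x-y≋0⇒x≋y P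

  x≋y⇒x-y≋0 : ∀ {d} {x y : Vec Carrier d} → x ≋ y → x -ᵛ y ≋ 0ᵛ
  x≋y⇒x-y≋0 []      = []
  x≋y⇒x-y≋0 (p ∷ P) = x≈y⇒x-y≈0 p ∷ x≋y⇒x-y≋0 P

  +ᵛ-comm : ∀ {d} (x y : Vec Carrier d) → x +ᵛ y ≋ y +ᵛ x
  +ᵛ-comm []      []      = []
  +ᵛ-comm (a ∷ x) (b ∷ y) = +-comm a b ∷ +ᵛ-comm x y

  +ᵛ-identityˡ : ∀ {d} (x : Vec Carrier d) → 0ᵛ +ᵛ x ≋ x
  +ᵛ-identityˡ []      = []
  +ᵛ-identityˡ (a ∷ x) = +-identityˡ a ∷ +ᵛ-identityˡ x

  +ᵛ-identityʳ : ∀ {d} (x : Vec Carrier d) → x +ᵛ 0ᵛ ≋ x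
  +ᵛ-identityʳ []      = []
  +ᵛ-identityʳ (a ∷ x) = +-identityʳ a ∷ +ᵛ-identityʳ x

  *ᵛ-identityˡ : ∀ {d} (x : Vec Carrier d) → 1# *ᵛ x ≋ x
  *ᵛ-identityˡ []      = []
  *ᵛ-identityˡ (a ∷ x) = *-identityˡ a ∷ *ᵛ-identityˡ x

  *ᵛ-zeroˡ : ∀ {d} (x : Vec Carrier d) → 0# *ᵛ x ≋ 0ᵛ
  *ᵛ-zeroˡ []      = []
  *ᵛ-zeroˡ (a ∷ x) = zeroˡ a ∷ *ᵛ-zeroˡ x

  *ᵛ-zeroʳ : ∀ {d} c → c *ᵛ 0ᵛ {d} ≋ 0ᵛ
  *ᵛ-zeroʳ {zero}  c = []
  *ᵛ-zeroʳ {suc d} c = zeroʳ c ∷ *ᵛ-zeroʳ c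

  *ᵛ-assoc : ∀ {d} a b (x : Vec Carrier d) → (a ⊗ b) *ᵛ x ≋ a *ᵛ b *ᵛ x
  *ᵛ-assoc a b []      = []
  *ᵛ-assoc a b (c ∷ x) = *-assoc a b c ∷ *ᵛ-assoc a b x

  *ᵛ-distribˡ-+ᵛ : ∀ {d} c (x y : Vec Carrier d) → c *ᵛ (x +ᵛ y) ≋ c *ᵛ x +ᵛ c *ᵛ y
  *ᵛ-distribˡ-+ᵛ c []      []      = []
  *ᵛ-distribˡ-+ᵛ c (a ∷ x) (b ∷ y) = distribˡ c a b ∷ *ᵛ-distribˡ-+ᵛ c x y

  ≋0-+ᵛ : ∀ {d} {x y : Vec Carrier d} → x ≋ 0ᵛ → y ≋ 0ᵛ → x +ᵛ y ≋ 0ᵛ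
  ≋0-+ᵛ p q = ≋-trans (+ᵛ-cong p q) (+ᵛ-identityˡ 0ᵛ)

  ≋0--ᵛ : ∀ {d} {x y : Vec Carrier d} → x ≋ 0ᵛ → y ≋ 0ᵛ → x -ᵛ y ≋ 0ᵛ
  ≋0--ᵛ p q = x≋y⇒x-y≋0 (≋-trans p (≋-sym q))

  ≋0-*ᵛ : ∀ {d} c {x : Vec Carrier d} → x ≋ 0ᵛ → c *ᵛ x ≋ 0ᵛ
  ≋0-*ᵛ c p = ≋-trans (*ᵛ-cong ≈-refl p) (*ᵛ-zeroʳ c)

  ·-cong : ∀ {d} {x x′ y y′ : Vec Carrier d} → x ≋ x′ → y ≋ y′ → x · y ≈ x′ · y′
  ·-cong []      []      = ≈-refl
  ·-cong (p ∷ P) (q ∷ Q) = +-cong (*-cong p q) (·-cong P Q)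

  ·-congˡ : ∀ {d} (x : Vec Carrier d) {y y′} → y ≋ y′ → x · y ≈ x · y′
  ·-congˡ x = ·-cong (≋-refl {x = x})

  ·-congʳ : ∀ {d} {x x′} (y : Vec Carrier d) → x ≋ x′ → x · y ≈ x′ · y
  ·-congʳ y p = ·-cong p (≋-refl {x = y})

  ·-comm : ∀ {d} (x y : Vec Carrier d) → x · y ≈ y · x
  ·-comm []      []      = ≈-refl
  ·-comm (a ∷ x) (b ∷ y) = +-cong (*-comm a b) (·-comm x y)

  ·-+ʳ : ∀ {d} (x y z : Vec Carrier d) → x · (y +ᵛ z) ≈ x · y ⊕ x · z
  ·-+ʳ []      []      []      = ≈-sym (+-identityˡ 0#)
  ·-+ʳ (a ∷ x) (b ∷ y) (c ∷ z) =
    ≈-trans (+-cong (distribˡ a b c) (·-+ʳ x y z)) (interchange (a ⊗ b) (a ⊗ c) (x · y) (x · z))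

  ·--ʳ : ∀ {d} (x y z : Vec Carrier d) → x · (y -ᵛ z) ≈ x · y ⊖ x · z
  ·--ʳ []      []      []      = ≈-sym 0-0≈0
  ·--ʳ (a ∷ x) (b ∷ y) (c ∷ z) =
    ≈-trans (+-cong (x[y-z]≈xy-xz a b c) (·--ʳ x y z)) (≈-sym (-‿interchange (a ⊗ b) (x · y) (a ⊗ c) (x · z)))

  ·-*ʳ : ∀ {d} (x : Vec Carrier d) c y → x · (c *ᵛ y) ≈ c ⊗ (x · y)
  ·-*ʳ []      c []      = ≈-sym (zeroʳ c)
  ·-*ʳ (a ∷ x) c (b ∷ y) = ≈-trans (+-cong (x*yz≈y*xz a c b) (·-*ʳ x c y)) (≈-sym (distribˡ c (a ⊗ b) (x · y)))

  ·-+ˡ : ∀ {d} (x y z : Vec Carrier d) → (x +ᵛ y) · z ≈ x · z ⊕ y · z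
  ·-+ˡ x y z = ≈-trans (·-comm _ z) (≈-trans (·-+ʳ z x y) (+-cong (·-comm z x) (·-comm z y)))

  ·--ˡ : ∀ {d} (x y z : Vec Carrier d) → (x -ᵛ y) · z ≈ x · z ⊖ y · z
  ·--ˡ x y z = ≈-trans (·-comm _ z) (≈-trans (·--ʳ z x y) (+-cong (·-comm z x) (-‿cong (·-comm z y))))

  ·-*ˡ : ∀ {d} c (x y : Vec Carrier d) → (c *ᵛ x) · y ≈ c ⊗ (x · y)
  ·-*ˡ c x y = ≈-trans (·-comm _ y) (≈-trans (·-*ʳ y c x) (*-congˡ (·-comm y x)))

  ·-zeroʳ : ∀ {d} (x : Vec Carrier d) → x · 0ᵛ ≈ 0#
  ·-zeroʳ []      = ≈-refl
  ·-zeroʳ (a ∷ x) = ≈-trans (+-cong (zeroʳ a) (·-zeroʳ x)) (+-identityˡ 0#)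

  ·-≋0ʳ : ∀ {d} (x : Vec Carrier d) {y} → y ≋ 0ᵛ → x · y ≈ 0#
  ·-≋0ʳ x p = ≈-trans (·-congˡ x p) (·-zeroʳ x)

  ·-≋0ˡ : ∀ {d} {x : Vec Carrier d} y → x ≋ 0ᵛ → x · y ≈ 0#
  ·-≋0ˡ y p = ≈-trans (·-comm _ y) (·-≋0ʳ y p)

  -- Reading xs as a matrix with rows xs, mul xs y is the matrix-vector product and comb c xs
  -- the product of the row vector c with it; thus mul xs (comb c xs) applies the Gram matrix to c.
  mul : ∀ {d j} → Vec (Vec Carrier d) j → Vec Carrier d → Vec Carrier j
  mul xs y = Vec.map (_· y) xs

  comb : ∀ {d j} → Vec Carrier j → Vec (Vec Carrier d) j → Vec Carrier d
  comb cs xs = foldr _ _+ᵛ_ 0ᵛ (zipWith _*ᵛ_ cs xs)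

  mul-cong : ∀ {d j} (xs : Vec (Vec Carrier d) j) {y y′} → y ≋ y′ → mul xs y ≋ mul xs y′
  mul-cong []       p = []
  mul-cong (x ∷ xs) p = ·-congˡ x p ∷ mul-cong xs p

  mul-+ : ∀ {d j} (xs : Vec (Vec Carrier d) j) y z → mul xs (y +ᵛ z) ≋ mul xs y +ᵛ mul xs z
  mul-+ []       y z = []
  mul-+ (x ∷ xs) y z = ·-+ʳ x y z ∷ mul-+ xs y z

  mul-- : ∀ {d j} (xs : Vec (Vec Carrier d) j) y z → mul xs (y -ᵛ z) ≋ mul xs y -ᵛ mul xs z
  mul-- []       y z = []
  mul-- (x ∷ xs) y z = ·--ʳ x y z ∷ mul-- xs y z

  mul-* : ∀ {d j} (xs : Vec (Vec Carrier d) j) c y → mul xs (c *ᵛ y) ≋ c *ᵛ mul xs y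
  mul-* []       c y = []
  mul-* (x ∷ xs) c y = ·-*ʳ x c y ∷ mul-* xs c y

  comb-· : ∀ {d j} (c : Vec Carrier j) (xs : Vec (Vec Carrier d) j) y → comb c xs · y ≈ c · mul xs y
  comb-· []      []       y = ·-≋0ˡ y ≋-refl
  comb-· (c ∷ cs) (x ∷ xs) y =
    ≈-trans (·-+ˡ (c *ᵛ x) (comb cs xs) y) (+-cong (·-*ˡ c x y) (comb-· cs xs y))

  comb-≋0 : ∀ {d j} {c : Vec Carrier j} (xs : Vec (Vec Carrier d) j) → c ≋ 0ᵛ → comb c xs ≋ 0ᵛ
  comb-≋0 {c = []}    []       []      = ≋-refl
  comb-≋0 {c = _ ∷ _} (x ∷ xs) (p ∷ P) =
    ≋0-+ᵛ (≋-trans (*ᵛ-cong p ≋-refl) (*ᵛ-zeroˡ x)) (comb-≋0 xs P)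

  comb-* : ∀ {d j} γ (c : Vec Carrier j) (xs : Vec (Vec Carrier d) j) → comb (γ *ᵛ c) xs ≋ γ *ᵛ comb c xs
  comb-* γ []      []       = ≋-sym (*ᵛ-zeroʳ γ)
  comb-* γ (c ∷ cs) (x ∷ xs) = ≋-trans (+ᵛ-cong (*ᵛ-assoc γ c x) (comb-* γ cs xs))
    (≋-sym (*ᵛ-distribˡ-+ᵛ γ (c *ᵛ x) (comb cs xs)))

  comb-- : ∀ {d j} (c c′ : Vec Carrier j) (xs : Vec (Vec Carrier d) j) →
           comb (c -ᵛ c′) xs ≋ comb c xs -ᵛ comb c′ xs
  comb-- []      []        []       = ≋-sym (≋0--ᵛ ≋-refl ≋-refl)
  comb-- (c ∷ cs) (c′ ∷ cs′) (x ∷ xs) =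
    ≋-trans (+ᵛ-cong ≋-refl (comb-- cs cs′ xs)) (step x (comb cs xs) (comb cs′ xs))
    where
    step : ∀ {d} (x y z : Vec Carrier d) → (c ⊖ c′) *ᵛ x +ᵛ (y -ᵛ z) ≋ c *ᵛ x +ᵛ y -ᵛ (c′ *ᵛ x +ᵛ z)
    step []      []      []      = []
    step (a ∷ x) (b ∷ y) (e ∷ z) = ≈-trans
      (+-congʳ (≈-trans (distribʳ a c (- c′)) (+-congˡ (≈-sym (-‿distribˡ-* c′ a)))))
      (≈-sym (-‿interchange (c ⊗ a) b (c′ ⊗ a) e)) ∷ step x y z

  Gram : ∀ {d j} → Vec (Vec Carrier d) j → Vec Carrier j → Vec Carrier j
  Gram xs c = mul xs (comb c xs)

  Gram-- : ∀ {d j} (xs : Vec (Vec Carrier d) j) c c′ → Gram xs (c -ᵛ c′) ≋ Gram xs c -ᵛ Gram xs c′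
  Gram-- xs c c′ = ≋-trans (mul-cong xs (comb-- c c′ xs)) (mul-- xs _ _)

  Gram-* : ∀ {d j} (xs : Vec (Vec Carrier d) j) γ c → Gram xs (γ *ᵛ c) ≋ γ *ᵛ Gram xs c
  Gram-* xs γ c = ≋-trans (mul-cong xs (comb-* γ c xs)) (mul-* xs γ _)

  Gram-symmetric : ∀ {d j} (xs : Vec (Vec Carrier d) j) c c′ → c · Gram xs c′ ≈ c′ · Gram xs c
  Gram-symmetric xs c c′ = begin
    c · Gram xs c′            ≈⟨ comb-· c xs _ ⟨
    comb c xs · comb c′ xs    ≈⟨ ·-comm (comb c xs) _ ⟩
    comb c′ xs · comb c xs    ≈⟨ comb-· c′ xs _ ⟩
    c′ · Gram xs c            ∎

  -- The Gram matrix of xs, bordered by the column b, has independent rows.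
  Nondeg : ∀ {d j} → Vec (Vec Carrier d) j → Vec Carrier j → Set
  Nondeg xs b = ∀ c → Gram xs c ≋ 0ᵛ → c · b ≈ 0# → c ≋ 0ᵛ

  -- The bordered Gram matrix with column b, row a and corner t has trivial kernel.
  Ker : ∀ {d j} → Vec (Vec Carrier d) j → Vec Carrier j → Vec Carrier j → Carrier → Set
  Ker xs a b t = ∀ c γ → Gram xs c +ᵛ γ *ᵛ b ≋ 0ᵛ → c · a ⊕ γ ⊗ t ≈ 0# → γ ≈ 0# × c ≋ 0ᵛ

  -- The row of the enlarged Gram matrix that contains `x · x` is simply dropped. The remaining rows
  -- together with the new border form the system with column `a` and row `b`, hence `Ker` with the
  -- two borders exchanged.
  Nondeg-∷ : ∀ {d j} {xs : Vec (Vec Carrier d) j} {x a b t} →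
             mul xs x ≋ a → Ker xs b a t → Nondeg (x ∷ xs) (t ∷ b)
  Nondeg-∷ {xs = xs} {x} {a} {b} {t} xsx≋a ker (γ ∷ c) (_ ∷ G≋0) c·b≈0 =
    let γ≈0 , c≋0 = ker c γ
          (≋-trans (≋-trans (+ᵛ-comm _ _) (+ᵛ-cong (≋-trans (*ᵛ-cong ≈-refl (≋-sym xsx≋a)) (≋-sym (mul-* xs γ x))) ≋-refl))
                   (≋-trans (≋-sym (mul-+ xs (γ *ᵛ x) (comb c xs))) G≋0))
          (≈-trans (+-comm _ _) c·b≈0)
    in γ≈0 ∷ c≋0

  -- The difference `w` of the two coefficient vectors satisfies `Gram xs w ≋ 0ᵛ`; and `w · b`
  -- vanishes because `c · Gram xs c′` is symmetric in `c` and `c′`.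
  comb-unique : ∀ {d j} {xs : Vec (Vec Carrier d) j} {b} → Nondeg xs b → ∀ {y y′ c c′} →
                mul xs y ≋ b → mul xs y′ ≋ b → y ≋ comb c xs → y′ ≋ comb c′ xs → y ≋ y′
  comb-unique {xs = xs} {b} nondeg {y} {y′} {c} {c′} yb y′b yc y′c′ =
    ≋-trans yc (≋-trans (x-y≋0⇒x≋y (≋-trans (≋-sym (comb-- c c′ xs)) (comb-≋0 xs w≋0))) (≋-sym y′c′))
    where
    Gc≋b : Gram xs c ≋ b
    Gc≋b = ≋-trans (mul-cong xs (≋-sym yc)) yb
    Gc′≋b : Gram xs c′ ≋ b
    Gc′≋b = ≋-trans (mul-cong xs (≋-sym y′c′)) y′b
    w≋0 : c -ᵛ c′ ≋ 0ᵛ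
    w≋0 = nondeg (c -ᵛ c′)
      (≋-trans (Gram-- xs c c′) (x≋y⇒x-y≋0 (≋-trans Gc≋b (≋-sym Gc′≋b))))
      (≈-trans (·--ˡ c c′ b) (x≈y⇒x-y≈0 (begin
        c · b            ≈⟨ ·-congˡ c (≋-sym Gc′≋b) ⟩
        c · Gram xs c′   ≈⟨ Gram-symmetric xs c c′ ⟩
        c′ · Gram xs c   ≈⟨ ·-congˡ c′ Gc≋b ⟩
        c′ · b           ∎)))

  -- The dot products of the combination `z` with `xs` and with `x` are the rows of the bordered
  -- system evaluated at `(c , γ)`.
  Ker⇒≋0 : ∀ {d j} {xs : Vec (Vec Carrier d) j} {a b t} → Ker xs a b t → ∀ {x y z γ c} →
           mul xs x ≋ a → mul xs y ≋ b → x · y ≈ t → mul xs z ≋ 0ᵛ → x · z ≈ 0# →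
           z ≋ comb (γ ∷ c) (y ∷ xs) → z ≋ 0ᵛ
  Ker⇒≋0 {xs = xs} {a} {b} {t} ker {x} {y} {z} {γ} {c} xa yb xy≈t z⊥ xz≈0 z≋ =
    let γ≈0 , c≋0 = ker c γ
          (≋-trans (+ᵛ-comm _ _) (≋-trans (+ᵛ-cong (≋-trans (*ᵛ-cong ≈-refl (≋-sym yb)) (≋-sym (mul-* xs γ y))) ≋-refl)
            (≋-trans (≋-sym (mul-+ xs (γ *ᵛ y) (comb c xs))) (≋-trans (mul-cong xs (≋-sym z≋)) z⊥))))
          (begin
            c · a ⊕ γ ⊗ t                         ≈⟨ +-comm _ _ ⟩
            γ ⊗ t ⊕ c · a                         ≈⟨ +-cong (*-congˡ (≈-sym xy≈t)) (·-congˡ c (≋-sym xa)) ⟩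
            γ ⊗ (x · y) ⊕ c · mul xs x            ≈⟨ +-cong (·-*ʳ x γ y) (comb-· c xs x) ⟨
            x · (γ *ᵛ y) ⊕ comb c xs · x          ≈⟨ +-congˡ (·-comm (comb c xs) x) ⟩
            x · (γ *ᵛ y) ⊕ x · comb c xs          ≈⟨ ·-+ʳ x (γ *ᵛ y) (comb c xs) ⟨
            x · (γ *ᵛ y +ᵛ comb c xs)             ≈⟨ ·-congˡ x (≋-sym z≋) ⟩
            x · z                                 ≈⟨ xz≈0 ⟩
            0#                                    ∎)
    in ≋-trans z≋ (comb-≋0 (y ∷ xs) (γ≈0 ∷ c≋0))

  -- Over a field the bordered matrix is singular for at most one value of its corner: a kernel
  -- vector can be normalised to (c₀ , 1), which then determines t = - c₀ · a.
  exclude : (∀ a → a ≈ 0# ⊎ (∃ λ b → b ⊗ a ≈ 1#)) →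
            ∀ {d j} (xs : Vec (Vec Carrier d) j) {a b} →
            Dec (∃ λ c → Gram xs c +ᵛ b ≋ 0ᵛ) → Nondeg xs a → Nondeg xs b →
            ∃ λ τ → ∀ {t} → ¬ t ≈ τ → Ker xs a b t
  -- If `b` is not in the image of the Gram matrix, `γ` must vanish whatever the corner is, so `0#`
  -- is an arbitrary default.
  exclude inv xs {a} {b} (no ¬c₀) na nb = 0# , λ _ c γ G≋0 ca≈0 → case inv γ of λ where
      (inj₁ γ≈0) → γ≈0 , na c
        (≋-trans (≋-sym (+ᵛ-identityʳ _)) (≋-trans (+ᵛ-cong ≋-refl
          (≋-sym (≋-trans (*ᵛ-cong γ≈0 ≋-refl) (*ᵛ-zeroˡ b)))) G≋0))
        (≈-trans (≈-sym (+-identityʳ _)) (≈-trans (+-congˡ (≈-sym (≈-trans (*-congʳ γ≈0) (zeroˡ _)))) ca≈0))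
      (inj₂ (g , gγ≈1)) → ⊥-elim (¬c₀ (g *ᵛ c ,
        ≋-trans (+ᵛ-cong (Gram-* xs g c)
          (≋-trans (≋-sym (*ᵛ-identityˡ b)) (≋-trans (*ᵛ-cong (≈-sym gγ≈1) ≋-refl) (*ᵛ-assoc g γ b))))
        (≋-trans (≋-sym (*ᵛ-distribˡ-+ᵛ g _ _)) (≋0-*ᵛ g G≋0))))
  exclude inv xs {a} {b} (yes (c₀ , Gc₀+b≋0)) na nb = - (c₀ · a) , kernel
    where
    kernel : ∀ {t} → ¬ t ≈ - (c₀ · a) → Ker xs a b t
    kernel {t} t≉ c γ G≋0 ca≈0 = γ≈0 , ≋-trans c≋γc₀ (≋-trans (*ᵛ-cong γ≈0 ≋-refl) (*ᵛ-zeroˡ c₀))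
      where
      w = c -ᵛ γ *ᵛ c₀
      cancelᵛ : ∀ {j} (g h b : Vec Carrier j) → g +ᵛ γ *ᵛ b ≋ 0ᵛ → h +ᵛ b ≋ 0ᵛ → g -ᵛ γ *ᵛ h ≋ 0ᵛ
      cancelᵛ []      []      []      []      []      = []
      cancelᵛ (g ∷ G) (h ∷ H) (b ∷ B) (p ∷ P) (q ∷ Q) = (begin
        g ⊖ γ ⊗ h                               ≈⟨ +-identityʳ _ ⟨
        (g ⊖ γ ⊗ h) ⊕ 0#                        ≈⟨ +-congˡ (-‿inverseʳ (γ ⊗ b)) ⟨
        (g ⊖ γ ⊗ h) ⊕ (γ ⊗ b ⊖ γ ⊗ b)           ≈⟨ -‿interchange g (γ ⊗ b) (γ ⊗ h) (γ ⊗ b) ⟨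
        (g ⊕ γ ⊗ b) ⊖ (γ ⊗ h ⊕ γ ⊗ b)           ≈⟨ +-cong p (-‿cong (≈-sym (distribˡ γ h b))) ⟩
        0# ⊖ γ ⊗ (h ⊕ b)                        ≈⟨ x≈y⇒x-y≈0 (≈-sym (≈-trans (*-congˡ q) (zeroʳ γ))) ⟩
        0#                                      ∎) ∷ cancelᵛ G H B P Q
      Gw≋0 : Gram xs w ≋ 0ᵛ
      Gw≋0 = ≋-trans (Gram-- xs c (γ *ᵛ c₀)) (≋-trans (-ᵛ-cong ≋-refl (Gram-* xs γ c₀))
               (cancelᵛ _ _ b G≋0 Gc₀+b≋0))
      -- By symmetry the kernel of the Gram matrix is orthogonal to its image, in particular to `b`,
      -- which is minus `Gram xs c₀`.
      wb≈0 : w · b ≈ 0#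
      wb≈0 = begin
        w · b                       ≈⟨ +-identityˡ _ ⟨
        0# ⊕ w · b                  ≈⟨ +-congʳ (≈-trans (Gram-symmetric xs w c₀) (·-≋0ʳ c₀ Gw≋0)) ⟨
        w · Gram xs c₀ ⊕ w · b      ≈⟨ ·-+ʳ w _ b ⟨
        w · (Gram xs c₀ +ᵛ b)       ≈⟨ ·-≋0ʳ w Gc₀+b≋0 ⟩
        0#                          ∎
      c≋γc₀ : c ≋ γ *ᵛ c₀
      c≋γc₀ = x-y≋0⇒x≋y (nb w Gw≋0 wb≈0)
      γ*≈0 : γ ⊗ (c₀ · a ⊕ t) ≈ 0#
      γ*≈0 = begin
        γ ⊗ (c₀ · a ⊕ t)          ≈⟨ distribˡ γ _ t ⟩
        γ ⊗ (c₀ · a) ⊕ γ ⊗ t      ≈⟨ +-congʳ (·-*ˡ γ c₀ a) ⟨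
        (γ *ᵛ c₀) · a ⊕ γ ⊗ t     ≈⟨ +-congʳ (·-congʳ a (≋-sym c≋γc₀)) ⟩
        c · a ⊕ γ ⊗ t             ≈⟨ ca≈0 ⟩
        0#                        ∎
      γ≈0 : γ ≈ 0#
      γ≈0 with inv (c₀ · a ⊕ t)
      ... | inj₁ ≈0 = ⊥-elim (t≉ (x-y≈0⇒x≈y
              (≈-trans (+-congˡ (-‿involutive _)) (≈-trans (+-comm t _) ≈0))))
      ... | inj₂ (g , g≈1) = begin
        γ                             ≈⟨ *-identityˡ γ ⟨
        1# ⊗ γ                        ≈⟨ *-congʳ (≈-sym g≈1) ⟩
        g ⊗ (c₀ · a ⊕ t) ⊗ γ          ≈⟨ ≈-trans (*-assoc g _ γ) (*-congˡ (*-comm _ γ)) ⟩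
        g ⊗ (γ ⊗ (c₀ · a ⊕ t))        ≈⟨ ≈-trans (*-congˡ γ*≈0) (zeroʳ g) ⟩
        0#                            ∎

-- Non-units and the residue field

module ValuationRing (R : FiniteValuationRing) where
  open FiniteValuationRing R
    using (cring; size; enum; enum-inj; enum-surj; nontrivial; local; chain; isUnit?; residueCard)
    renaming (_≟_ to infix 4 _≈?_)
  open CommutativeRing cring
    renaming (_+_ to _⊕_; _*_ to _⊗_; _-_ to _⊖_; refl to ≈-refl; sym to ≈-sym; trans to ≈-trans; zero to ⊗-zero)
  open Linear cring
  module ≈-Reasoning = SetoidReasoning setoid

  NonUnit : Carrier → Set
  NonUnit x = ¬ IsUnit cring x

  NonUnit-resp : ∀ {x y} → x ≈ y → NonUnit x → NonUnit y
  NonUnit-resp x≈y ¬u (z , yz≈1) = ¬u (z , ≈-trans (*-congʳ x≈y) yz≈1)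

  NonUnit-0 : NonUnit 0#
  NonUnit-0 (z , 0z≈1) = nontrivial (≈-trans (≈-sym 0z≈1) (zeroˡ z))

  NonUnit-* : ∀ c {x} → NonUnit x → NonUnit (c ⊗ x)
  NonUnit-* c {x} ¬u (z , cxz≈1) = ¬u (c ⊗ z , ≈-trans (≈-trans (x*yz≈y*xz x c z) (≈-sym (*-assoc c x z))) cxz≈1)

  NonUnit-neg : ∀ {x} → NonUnit x → NonUnit (- x)
  NonUnit-neg {x} ¬u = NonUnit-resp (≈-trans (≈-sym (-‿distribˡ-* 1# x)) (-‿cong (*-identityˡ x)))
    (NonUnit-* (- 1#) ¬u)

  infix 4 _~_ _~?_ _~ᵛ_ _~ᵛ?_ _≋?_

  _~_ : Carrier → Carrier → Set
  x ~ y = NonUnit (x ⊖ y)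

  _~?_ : Decidable₂ _~_
  x ~? y = ¬? (isUnit? (x ⊖ y))

  ≈⇒~ : ∀ {x y} → x ≈ y → x ~ y
  ≈⇒~ x≈y = NonUnit-resp (≈-sym (x≈y⇒x-y≈0 x≈y)) NonUnit-0

  x⊖0≈x : ∀ x → x ⊖ 0# ≈ x
  x⊖0≈x x = ≈-trans (≈-sym (+-congʳ (+-identityʳ x))) (x+y-y≈x x 0#)

  NonUnit⇒~0 : ∀ {x} → NonUnit x → x ~ 0#
  NonUnit⇒~0 = NonUnit-resp (≈-sym (x⊖0≈x _))

  ~0⇒NonUnit : ∀ {x} → x ~ 0# → NonUnit x
  ~0⇒NonUnit = NonUnit-resp (x⊖0≈x _)

  ~-sym : ∀ {x y} → x ~ y → y ~ x
  ~-sym {x} {y} p = NonUnit-resp (begin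
    - (x ⊖ y)        ≈⟨ -‿+-comm x (- y) ⟨
    - x ⊕ - (- y)    ≈⟨ +-congˡ (-‿involutive y) ⟩
    - x ⊕ y          ≈⟨ +-comm (- x) y ⟩
    y ⊖ x            ∎) (NonUnit-neg p)
    where open ≈-Reasoning

  ~-trans : ∀ {x y z} → x ~ y → y ~ z → x ~ z
  ~-trans {x} {y} {z} p q = NonUnit-resp (begin
    (x ⊖ y) ⊕ (y ⊖ z)     ≈⟨ +-assoc (x ⊖ y) y (- z) ⟨
    ((x ⊖ y) ⊕ y) ⊖ z     ≈⟨ +-congʳ (x-y+y≈x x y) ⟩
    x ⊖ z                 ∎) (local _ _ p q)
    where open ≈-Reasoning

  -- The residue field, as the ring R with equality weakened to congruence modulo the maximal ideal.
  residueField : CommutativeRing 0ℓ 0ℓ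
  residueField = record
    { Carrier = Carrier ; _≈_ = _~_ ; _+_ = _⊕_ ; _*_ = _⊗_ ; -_ = -_ ; 0# = 0# ; 1# = 1#
    ; isCommutativeRing = record
      { isRing = record
        { +-isAbelianGroup = record
          { isGroup = record
            { isMonoid = record
              { isSemigroup = record
                { isMagma = record
                  { isEquivalence = record { refl = ≈⇒~ ≈-refl ; sym = ~-sym ; trans = ~-trans }
                  ; ∙-cong = λ {x} {y} {u} {v} p q → NonUnit-resp (≈-sym (-‿interchange x u y v)) (local _ _ p q)
                  }
                ; assoc = λ x y z → ≈⇒~ (+-assoc x y z)
                }
              ; identity = (λ x → ≈⇒~ (+-identityˡ x)) , (λ x → ≈⇒~ (+-identityʳ x))
              }
            ; inverse = (λ x → ≈⇒~ (-‿inverseˡ x)) , (λ x → ≈⇒~ (-‿inverseʳ x))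
            ; ⁻¹-cong = λ {x} {y} p → NonUnit-resp (≈-sym (-‿+-comm x (- y))) (NonUnit-neg p)
            }
          ; comm = λ x y → ≈⇒~ (+-comm x y)
          }
        ; *-cong = λ {x} {y} {u} {v} p q → ~-trans (*-~ x q)
            (~-trans (≈⇒~ (*-comm x v)) (~-trans (*-~ v p) (≈⇒~ (*-comm v y))))
        ; *-assoc = λ x y z → ≈⇒~ (*-assoc x y z)
        ; *-identity = (λ x → ≈⇒~ (*-identityˡ x)) , (λ x → ≈⇒~ (*-identityʳ x))
        ; distrib = (λ x y z → ≈⇒~ (distribˡ x y z)) , (λ x y z → ≈⇒~ (distribʳ x y z))
        }
      ; *-comm = λ x y → ≈⇒~ (*-comm x y)
      }
    }
    where
    *-~ : ∀ c {x y} → x ~ y → c ⊗ x ~ c ⊗ y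
    *-~ c {x} {y} p = NonUnit-resp (x[y-z]≈xy-xz c x y) (NonUnit-* c p)

  module κ = Linear residueField

  residueField-inverse : ∀ x → x ~ 0# ⊎ (∃ λ y → y ⊗ x ~ 1#)
  residueField-inverse x with isUnit? x
  ... | yes (y , xy≈1) = inj₂ (y , ≈⇒~ (≈-trans (*-comm y x) xy≈1))
  ... | no ¬u          = inj₁ (NonUnit⇒~0 ¬u)

  _~ᵛ_ : ∀ {d} → Vec Carrier d → Vec Carrier d → Set
  _~ᵛ_ = Pointwise _~_

  _~ᵛ?_ : ∀ {d} → Decidable₂ (_~ᵛ_ {d})
  _~ᵛ?_ = PW.decidable _~?_

  _≋?_ : ∀ {d} → Decidable₂ (_≋_ {d})
  _≋?_ = PW.decidable _≈?_

  ≋⇒~ᵛ : ∀ {d} {x y : Vec Carrier d} → x ≋ y → x ~ᵛ y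
  ≋⇒~ᵛ = PW.map ≈⇒~

  ≋-isEquivalence : ∀ {d} → IsEquivalence (_≋_ {d})
  ≋-isEquivalence = record { refl = ≋-refl ; sym = ≋-sym ; trans = ≋-trans }

  zeroDivisor⇒NonUnit : ∀ {x y} → ¬ x ≈ 0# → x ⊗ y ≈ 0# → NonUnit y
  zeroDivisor⇒NonUnit {x} {y} x≉0 xy≈0 (z , yz≈1) = x≉0 (begin
    x              ≈⟨ *-identityʳ x ⟨
    x ⊗ 1#         ≈⟨ *-congˡ yz≈1 ⟨
    x ⊗ (y ⊗ z)    ≈⟨ *-assoc x y z ⟨
    x ⊗ y ⊗ z      ≈⟨ *-congʳ xy≈0 ⟩
    0# ⊗ z         ≈⟨ zeroˡ z ⟩
    0#             ∎)
    where open ≈-Reasoning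

  -- Divisibility and primitive vectors

  infix 4 _∣_ _∣?_

  _∣_ : Carrier → Carrier → Set
  x ∣ y = ∃ λ c → x ⊗ c ≈ y

  principal : Carrier → Ideal cring
  principal x = record
    { member   = x ∣_
    ; resp-≈   = λ y≈z (c , p) → c , ≈-trans p y≈z
    ; has-0    = 0# , zeroʳ x
    ; closed-+ = λ (c , p) (c′ , p′) → c ⊕ c′ , ≈-trans (distribˡ x c c′) (+-cong p p′)
    ; closed-* = λ r (c , p) → r ⊗ c , ≈-trans (x*yz≈y*xz x r c) (*-congˡ p)
    }

  ∣-total : ∀ x y → x ∣ y ⊎ y ∣ x
  ∣-total x y with chain (principal x) (principal y)
  ... | inj₁ ⊆ = inj₂ (⊆ (1# , *-identityʳ x))
  ... | inj₂ ⊇ = inj₁ (⊇ (1# , *-identityʳ y))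

  _∣?_ : Decidable₂ _∣_
  x ∣? y = map′ (λ (i , p) → enum i , p)
                (λ (c , p) → let i , ei≈c = enum-surj c in i , ≈-trans (*-congˡ ei≈c) p)
                (any? (λ i → x ⊗ enum i ≈? y))

  -- As divisibility is total, the entries of a nonzero vector have a gcd among themselves.
  primitivePart : ∀ {d} (z : Vec Carrier d) →
                  z ≋ 0ᵛ ⊎ (∃ λ γ → ∃ λ z′ → z ≋ γ *ᵛ z′ × ¬ γ ≈ 0# × ¬ z′ ~ᵛ 0ᵛ)
  primitivePart []      = inj₁ []
  primitivePart (a ∷ z) with primitivePart z
  ... | inj₁ z≋0 with a ≈? 0#
  ...   | yes a≈0 = inj₁ (a≈0 ∷ z≋0)
  ...   | no a≉0  = inj₂ (a , 1# ∷ 0ᵛ , ≈-sym (*-identityʳ a) ∷ ≋-trans z≋0 (≋-sym (*ᵛ-zeroʳ a)) , a≉0 ,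
                          λ { (1~0 ∷ _) → ~0⇒NonUnit 1~0 (1# , *-identityˡ 1#) })
  primitivePart (a ∷ z) | inj₂ (γ , z′ , z≋γz′ , γ≉0 , z′≁0) with ∣-total γ a
  ... | inj₁ (c , γc≈a) = inj₂ (γ , c ∷ z′ , ≈-sym γc≈a ∷ z≋γz′ , γ≉0 , λ { (_ ∷ p) → z′≁0 p })
  ... | inj₂ (c , ac≈γ) = inj₂ (a , 1# ∷ c *ᵛ z′ ,
        ≈-sym (*-identityʳ a) ∷ ≋-trans z≋γz′ (≋-trans (*ᵛ-cong (≈-sym ac≈γ) ≋-refl) (*ᵛ-assoc a c z′)) ,
        (λ a≈0 → γ≉0 (≈-trans (≈-sym ac≈γ) (≈-trans (*-congʳ a≈0) (zeroˡ c)))) ,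
        λ { (1~0 ∷ _) → ~0⇒NonUnit 1~0 (1# , *-identityˡ 1#) })

  ⟨⟩-* : {P Q S : Set} (P? : Dec P) (Q? : Dec Q) (S? : Dec S) →
         (S → P) → (S → Q) → (P → Q → S) → ⟨ S? ⟩ ≡ ⟨ P? ⟩ * ⟨ Q? ⟩
  ⟨⟩-* (yes p) (yes q) S? f g h = ⟨⟩-yes S? (h p q)
  ⟨⟩-* (yes p) (no ¬q) S? f g h = ⟨⟩-no S? (¬q ∘ g)
  ⟨⟩-* (no ¬p) Q?      S? f g h = ⟨⟩-no S? (¬p ∘ f)

  ∑-tuples-^ : {A : Set} (L : List A) (f : A → ℕ) (F : ∀ {d} → Vec A d → ℕ) → F [] ≡ 1 →
               (∀ {d} a (v : Vec A d) → F (a ∷ v) ≡ f a * F v) → ∀ d → ∑ (tuples d L) F ≡ ∑ L f ^ d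
  ∑-tuples-^ L f F F[] F∷ zero    = trans (ℕₚ.+-identityʳ (F [])) F[]
  ∑-tuples-^ L f F F[] F∷ (suc d) = begin
    ∑ (tuples (suc d) L) F                              ≡⟨ ∑-tuples d L F ⟩
    ∑[ x ∈ L ] ∑[ v ∈ tuples d L ] F (x ∷ v)            ≡⟨ ∑-cong L (λ x → ∑-cong (tuples d L) (F∷ x)) ⟩
    ∑[ x ∈ L ] ∑[ v ∈ tuples d L ] (f x * F v)          ≡⟨ ∑-product L (tuples d L) f F ⟩
    ∑ L f * ∑ (tuples d L) F                            ≡⟨ cong (∑ L f *_) (∑-tuples-^ L f F F[] F∷ d) ⟩
    ∑ L f * ∑ L f ^ d                                   ∎
    where open ≡-Reasoning

  -- Enumerating the ring and its residue classes

  elems : List Carrier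
  elems = map enum (allFin size)

  vecs : ∀ d → List (Vec Carrier d)
  vecs d = tuples d elems

  length-elems : length elems ≡ size
  length-elems = trans (length-map enum (allFin size)) (length-tabulate (λ i → i))

  ∑-elems-const : ∀ c → ∑[ _ ∈ elems ] c ≡ size * c
  ∑-elems-const c = trans (∑-const elems c) (cong (_* c) length-elems)

  ∑-vecs-1 : ∀ d → ∑[ _ ∈ vecs d ] 1 ≡ size ^ d
  ∑-vecs-1 d = trans (∑-tuples-^ elems (λ _ → 1) (λ _ → 1) refl (λ _ _ → refl) d)
    (cong (_^ d) (trans (∑-elems-const 1) (ℕₚ.*-identityʳ size)))

  open Enumeration isEquivalence _≈?_ using () renaming (Respects to RespectsElems; ∑-reindex to ∑-reindexElems)
  module EnumVecs {d} = Enumeration (≋-isEquivalence {d}) _≋?_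

  ∑-elems-≈ : ∀ v → ∑[ u ∈ elems ] ⟨ v ≈? u ⟩ ≡ 1
  ∑-elems-≈ v = trans (∑-map enum (allFin size) _) (≤-antisym
    (∑⟨⟩≤1 (λ i → v ≈? enum i) (allFin⁺ size)
      (λ v≈i v≈j i≢j → i≢j (enum-inj _ _ (≈-trans (≈-sym v≈i) v≈j))))
    (let i , ei≈v = enum-surj v in ≤-trans
      (≤-reflexive (sym (⟨⟩-yes (v ≈? enum i) (≈-sym ei≈v))))
      (∑-∈-≤ (λ i → ⟨ v ≈? enum i ⟩) (∈-allFin i))))

  ∑-vecs-≋ : ∀ {d} (v : Vec Carrier d) → ∑[ u ∈ vecs d ] ⟨ v ≋? u ⟩ ≡ 1
  ∑-vecs-≋ []      = refl
  ∑-vecs-≋ {suc d} (a ∷ v) = begin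
    ∑[ u ∈ vecs (suc d) ] ⟨ (a ∷ v) ≋? u ⟩                           ≡⟨ ∑-tuples d elems _ ⟩
    ∑[ b ∈ elems ] ∑[ u ∈ vecs d ] ⟨ (a ∷ v) ≋? (b ∷ u) ⟩            ≡⟨ ∑-cong elems (λ b → ∑-cong (vecs d) (λ u →
        ⟨⟩-* (a ≈? b) (v ≋? u) ((a ∷ v) ≋? (b ∷ u)) PW.head PW.tail _∷_)) ⟩
    ∑[ b ∈ elems ] ∑[ u ∈ vecs d ] (⟨ a ≈? b ⟩ * ⟨ v ≋? u ⟩)          ≡⟨ ∑-product elems (vecs d) _ _ ⟩
    ∑ elems (λ b → ⟨ a ≈? b ⟩) * ∑ (vecs d) (λ u → ⟨ v ≋? u ⟩)        ≡⟨ cong₂ _*_ (∑-elems-≈ a) (∑-vecs-≋ v) ⟩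
    1                                                                ∎
    where open ≡-Reasoning

  ∑-shift : ∀ {f} → RespectsElems f → ∀ c → ∑[ x ∈ elems ] f (x ⊕ c) ≡ ∑ elems f
  ∑-shift rf c = ∑-reindexElems elems ∑-elems-≈ rf (_⊕ c) (_⊖ c)
    (λ x+c≈u → ≈-trans (+-congʳ (≈-sym x+c≈u)) (x+y-y≈x _ c))
    (λ u-c≈x → ≈-trans (+-congʳ (≈-sym u-c≈x)) (x-y+y≈x _ c))

  ∑-shiftᵛ : ∀ {d} {f : Vec Carrier d → ℕ} → EnumVecs.Respects f → ∀ c → ∑[ x ∈ vecs d ] f (x +ᵛ c) ≡ ∑ (vecs d) f
  ∑-shiftᵛ rf c = EnumVecs.∑-reindex (vecs _) ∑-vecs-≋ rf (_+ᵛ c) (_-ᵛ c)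
    (λ x+c≋u → ≋-trans (-ᵛ-cong (≋-sym x+c≋u) ≋-refl) (x+y-y≋x _ c))
    (λ u-c≋x → ≋-trans (+ᵛ-cong (≋-sym u-c≋x) ≋-refl) (x-y+y≋x _ c))

  ∑-distinct-≤ : ∀ {d} {f : Vec Carrier d → ℕ} → EnumVecs.Respects f → {B : List (Vec Carrier d)} →
                 IsFinSet R B → ∑ B f ≤ ∑ (vecs d) f
  ∑-distinct-≤ = EnumVecs.∑-distinct-≤ (vecs _) ∑-vecs-≋

  length≤ : ∀ {d} {B : List (Vec Carrier d)} → IsFinSet R B → length B ≤ size ^ d
  length≤ {d} {B} B! = begin
    length B               ≡⟨ ℕₚ.*-identityʳ (length B) ⟨
    length B * 1           ≡⟨ ∑-const B 1 ⟨
    ∑[ _ ∈ B ] 1           ≤⟨ ∑-distinct-≤ (λ _ → refl) B! ⟩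
    ∑[ _ ∈ vecs d ] 1      ≡⟨ ∑-vecs-1 d ⟩
    size ^ d               ∎
    where open ≤-Reasoning

  ∈-vecs : ∀ {d} (v : Vec Carrier d) → ∃ λ u → u ∈ vecs d × v ≋ u
  ∈-vecs v with ∑-pos⇒∃ (vecs _) (λ u → ⟨ v ≋? u ⟩) (λ ≡0 → case trans (sym (∑-vecs-≋ v)) ≡0 of λ ())
  ... | u , u∈ , ≢0 with v ≋? u
  ...   | yes v≋u = u , u∈ , v≋u
  ...   | no _    = ⊥-elim (≢0 refl)

  ∃-vec? : ∀ {d} {P : Vec Carrier d → Set} → Decidable₁ P → (∀ {u v} → u ≋ v → P u → P v) → Dec (∃ P)
  ∃-vec? {d} P? resp with Any.any? P? (vecs d)
  ... | yes p = yes (Any.satisfied p)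
  ... | no ¬p = no λ (v , Pv) → let u , u∈ , v≋u = ∈-vecs v in
                  ¬p (Any.map (λ { refl → resp v≋u Pv }) u∈)

  μ : ℕ
  μ = ∑[ x ∈ elems ] ⟨ x ~? 0# ⟩

  ∑-residueClass : ∀ c → ∑[ x ∈ elems ] ⟨ x ~? c ⟩ ≡ μ
  ∑-residueClass c = sym (begin
    ∑[ x ∈ elems ] ⟨ x ~? 0# ⟩         ≡⟨ ∑-shift (λ {x} {y} x≈y → ⟨⟩-cong (x ~? 0#) (y ~? 0#)
                                             (~-trans (≈⇒~ (≈-sym x≈y))) (~-trans (≈⇒~ x≈y))) (- c) ⟨
    ∑[ x ∈ elems ] ⟨ x ⊖ c ~? 0# ⟩     ≡⟨ ∑-cong elems (λ x → ⟨⟩-cong (x ⊖ c ~? 0#) (x ~? c) ~0⇒NonUnit NonUnit⇒~0) ⟩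
    ∑[ x ∈ elems ] ⟨ x ~? c ⟩          ∎)
    where open ≡-Reasoning

  -- `residueCard` counts the least index of each residue class, so every element is congruent to
  -- exactly one of the counted representatives.
  size≡q*μ : size ≡ residueCard * μ
  size≡q*μ = sym (begin
    residueCard * μ                                        ≡⟨ ∑-const reps μ ⟨
    ∑[ _ ∈ reps ] μ                                        ≡⟨ ∑-cong reps (λ i → ∑-residueClass (enum i)) ⟨
    ∑[ i ∈ reps ] ∑[ x ∈ elems ] ⟨ x ~? enum i ⟩           ≡⟨ ∑-swap reps elems _ ⟩
    ∑[ x ∈ elems ] ∑[ i ∈ reps ] ⟨ x ~? enum i ⟩           ≡⟨ ∑-cong elems (λ x → ≤-antisym (unique x) (exists x)) ⟩
    ∑[ _ ∈ elems ] 1                                       ≡⟨ ∑-elems-const 1 ⟩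
    size * 1                                               ≡⟨ ℕₚ.*-identityʳ size ⟩
    size                                                   ∎)
    where
    open ≡-Reasoning
    IsRep : Fin size → Set
    IsRep i = ∀ j → j <ᶠ i → IsUnit cring (enum i ⊖ enum j)
    isRep? : Decidable₁ IsRep
    isRep? i = all? (λ j → (j <ᶠ? i) →-dec isUnit? (enum i ⊖ enum j))
    reps : List (Fin size)
    reps = filter isRep? (allFin size)
    unique : ∀ x → ∑[ i ∈ reps ] ⟨ x ~? enum i ⟩ ≤ 1
    unique x = subst (_≤ 1)
      (trans (∑-cong (allFin size) (λ i → ⟨⟩-* (isRep? i) (x ~? enum i) (isRep? i ×-dec (x ~? enum i)) proj₁ proj₂ _,_))
             (sym (∑-filter isRep? (allFin size) _)))
      (∑⟨⟩≤1 (λ i → isRep? i ×-dec (x ~? enum i)) (allFin⁺ size) λ {i} {j} (ri , x~i) (rj , x~j) i≢j →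
        case <-cmp i j of λ where
          (tri< i<j _ _) → ~-trans (~-sym x~j) x~i (rj i i<j)
          (tri≈ _ i≡j _) → i≢j i≡j
          (tri> _ _ j<i) → ~-trans (~-sym x~i) x~j (ri j j<i))
    exists : ∀ x → 1 ≤ ∑[ i ∈ reps ] ⟨ x ~? enum i ⟩
    -- The least index congruent to `x` is a representative: an earlier index congruent to it would
    -- be congruent to `x` as well.
    exists x with ¬∀⟶∃¬-smallest size (λ i → ¬ x ~ enum i) (λ i → ¬? (x ~? enum i))
                    (λ ∀¬ → let i , ei≈x = enum-surj x in ∀¬ i (≈⇒~ (≈-sym ei≈x)))
    ... | i , ¬¬x~i , smallest with x ~? enum i
    ...   | no ¬x~i = ⊥-elim (¬¬x~i ¬x~i)
    ...   | yes x~i = ≤-trans (≤-reflexive (sym (⟨⟩-yes (x ~? enum i) x~i)))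
                              (∑-∈-≤ (λ i → ⟨ x ~? enum i ⟩) (∈-filter⁺ isRep? (∈-allFin i) rep))
      where
      rep : IsRep i
      rep j j<i with isUnit? (enum i ⊖ enum j)
      ... | yes u = u
      ... | no ¬u = ⊥-elim (subst (λ j → ¬ x ~ enum j) (inject-fromℕ< j j<i)
                              (smallest (fromℕ< j<i)) (~-trans x~i ¬u))
        where
        inject-fromℕ< : ∀ j (j<i : j <ᶠ i) → inject {i = i} (fromℕ< j<i) ≡ j
        inject-fromℕ< j j<i = toℕ-injective (trans (toℕ-inject (fromℕ< j<i)) (toℕ-fromℕ< j<i))

  -- Annihilators and torsion

  ann : Carrier → ℕ
  ann s = ∑[ x ∈ elems ] ⟨ s ⊗ x ≈? 0# ⟩

  multiples : Carrier → ℕ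
  multiples s = ∑[ x ∈ elems ] ⟨ s ∣? x ⟩

  -- A fibre of the affine map is empty or a translate of the annihilator of `γ`.
  ann-≤ : ∀ s γ t → ∑[ x ∈ elems ] ⟨ s ⊕ γ ⊗ x ≈? t ⟩ ≤ ann γ
  ann-≤ s γ t with ∑ elems (λ x → ⟨ s ⊕ γ ⊗ x ≈? t ⟩) in eq
  ... | zero  = z≤n
  ... | suc n with ∑-pos⇒∃ elems (λ x → ⟨ s ⊕ γ ⊗ x ≈? t ⟩) (λ ≡0 → case trans (sym eq) ≡0 of λ ())
  ...   | x₀ , _ , ≢0 with s ⊕ γ ⊗ x₀ ≈? t
  ...     | no _  = ⊥-elim (≢0 refl)
  ...     | yes p = ≤-trans (≤-reflexive (sym eq)) (≤-trans
            (≤-reflexive (sym (∑-shift (λ {x} {y} x≈y → ⟨⟩-cong (_ ≈? t) (_ ≈? t)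
               (≈-trans (+-congˡ (*-congˡ (≈-sym x≈y)))) (≈-trans (+-congˡ (*-congˡ x≈y)))) x₀)))
            (∑-mono elems (λ x → ⟨⟩-mono (_ ≈? t) (γ ⊗ x ≈? 0#) (cancel x))))
    where
    open ≈-Reasoning
    cancel : ∀ x → s ⊕ γ ⊗ (x ⊕ x₀) ≈ t → γ ⊗ x ≈ 0#
    cancel x h = begin
      γ ⊗ x                                        ≈⟨ x+y-y≈x (γ ⊗ x) (s ⊕ γ ⊗ x₀) ⟨
      γ ⊗ x ⊕ (s ⊕ γ ⊗ x₀) ⊖ (s ⊕ γ ⊗ x₀)          ≈⟨ +-congʳ (x∙yz≈y∙xz (γ ⊗ x) s (γ ⊗ x₀)) ⟩
      s ⊕ (γ ⊗ x ⊕ γ ⊗ x₀) ⊖ (s ⊕ γ ⊗ x₀)          ≈⟨ +-congʳ (+-congˡ (distribˡ γ x x₀)) ⟨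
      s ⊕ γ ⊗ (x ⊕ x₀) ⊖ (s ⊕ γ ⊗ x₀)              ≈⟨ x≈y⇒x-y≈0 (≈-trans h (≈-sym p)) ⟩
      0#                                           ∎

  -- Multiplication by `z` takes every multiple of `z` at least `ann z` times, on a translate of the
  -- annihilator.
  ann*multiples≤size : ∀ z → ann z * multiples z ≤ size
  ann*multiples≤size z = begin
    ann z * multiples z                              ≡⟨ ∑-*ˡ elems (ann z) _ ⟨
    ∑[ w ∈ elems ] (ann z * ⟨ z ∣? w ⟩)              ≤⟨ ∑-mono elems fibre ⟩
    ∑[ w ∈ elems ] ∑[ x ∈ elems ] ⟨ z ⊗ x ≈? w ⟩      ≡⟨ ∑-swap elems elems _ ⟩
    ∑[ x ∈ elems ] ∑[ w ∈ elems ] ⟨ z ⊗ x ≈? w ⟩      ≡⟨ ∑-cong elems (λ x → ∑-elems-≈ (z ⊗ x)) ⟩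
    ∑[ _ ∈ elems ] 1                                 ≡⟨ ∑-elems-const 1 ⟩
    size * 1                                         ≡⟨ ℕₚ.*-identityʳ size ⟩
    size                                             ∎
    where
    open ≤-Reasoning
    fibre : ∀ w → ann z * ⟨ z ∣? w ⟩ ≤ ∑[ x ∈ elems ] ⟨ z ⊗ x ≈? w ⟩
    fibre w with z ∣? w
    ... | no _  = ≤-trans (≤-reflexive (*-zeroʳ (ann z))) z≤n
    ... | yes (c , zc≈w) = begin
      ann z * 1                                ≡⟨ ℕₚ.*-identityʳ (ann z) ⟩
      ann z                                    ≤⟨ ∑-mono elems (λ x → ⟨⟩-mono (z ⊗ x ≈? 0#) (z ⊗ (x ⊕ c) ≈? w)
                                                    (λ p → ≈-trans (distribˡ z x c) (≈-trans (+-cong p zc≈w) (+-identityˡ w)))) ⟩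
      ∑[ x ∈ elems ] ⟨ z ⊗ (x ⊕ c) ≈? w ⟩       ≡⟨ ∑-shift (λ x≈y → ⟨⟩-cong (_ ≈? w) (_ ≈? w)
                                                    (≈-trans (*-congˡ (≈-sym x≈y))) (≈-trans (*-congˡ x≈y))) c ⟩
      ∑[ x ∈ elems ] ⟨ z ⊗ x ≈? w ⟩             ∎

  ann≤μ : ∀ {s} → ¬ s ≈ 0# → ann s ≤ μ
  ann≤μ {s} s≉0 = ∑-mono elems (λ x → ⟨⟩-mono (s ⊗ x ≈? 0#) (x ~? 0#) (NonUnit⇒~0 ∘ zeroDivisor⇒NonUnit s≉0))

  ∑-annᵛ : ∀ s d → ∑[ v ∈ vecs d ] ⟨ s *ᵛ v ≋? 0ᵛ ⟩ ≡ ann s ^ d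
  ∑-annᵛ s = ∑-tuples-^ elems (λ x → ⟨ s ⊗ x ≈? 0# ⟩) (λ v → ⟨ s *ᵛ v ≋? 0ᵛ ⟩) refl
    (λ a v → ⟨⟩-* (s ⊗ a ≈? 0#) (s *ᵛ v ≋? 0ᵛ) ((s *ᵛ (a ∷ v)) ≋? 0ᵛ) PW.head PW.tail _∷_)

  ∑-residueClassᵛ : ∀ {d} (c : Vec Carrier d) → ∑[ v ∈ vecs d ] ⟨ v ~ᵛ? c ⟩ ≡ μ ^ d
  ∑-residueClassᵛ []      = refl
  ∑-residueClassᵛ {suc d} (a ∷ c) = begin
    ∑[ u ∈ vecs (suc d) ] ⟨ u ~ᵛ? (a ∷ c) ⟩                           ≡⟨ ∑-tuples d elems _ ⟩
    ∑[ b ∈ elems ] ∑[ u ∈ vecs d ] ⟨ (b ∷ u) ~ᵛ? (a ∷ c) ⟩            ≡⟨ ∑-cong elems (λ b → ∑-cong (vecs d) (λ u →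
        ⟨⟩-* (b ~? a) (u ~ᵛ? c) ((b ∷ u) ~ᵛ? (a ∷ c)) PW.head PW.tail _∷_)) ⟩
    ∑[ b ∈ elems ] ∑[ u ∈ vecs d ] (⟨ b ~? a ⟩ * ⟨ u ~ᵛ? c ⟩)         ≡⟨ ∑-product elems (vecs d) _ _ ⟩
    ∑ elems (λ b → ⟨ b ~? a ⟩) * ∑ (vecs d) (λ u → ⟨ u ~ᵛ? c ⟩)       ≡⟨ cong₂ _*_ (∑-residueClass a) (∑-residueClassᵛ c) ⟩
    μ * μ ^ d                                                         ∎
    where open ≡-Reasoning

  -- The number of pairs of a nonzero scalar `s` and a vector of length d killed by `s`.
  torsion : ℕ → ℕ
  torsion d = ∑[ s ∈ elems ] (⟨ ¬? (s ≈? 0#) ⟩ * ann s ^ d)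

  -- Of two elements killed by s ≠ 0 one divides the other, and both are non-units; so
  -- the triples (s , z , w) with s z = s w = 0 are counted by ∑ |Ann z| |z R| ≤ ∑ |R| over z ∈ 𝔪.
  torsion-2 : torsion 2 ≤ 2 * (μ * size)
  torsion-2 = begin
    torsion 2
      ≡⟨ ∑-cong elems (λ s → trans (cong (λ n → ⟨ ¬? (s ≈? 0#) ⟩ * (ann s * n)) (ℕₚ.*-identityʳ (ann s)))
           (trans (cong (⟨ ¬? (s ≈? 0#) ⟩ *_) (sym (∑-product elems elems _ _)))
           (trans (sym (∑-*ˡ elems ⟨ ¬? (s ≈? 0#) ⟩ _)) (∑-cong elems (λ z → sym (∑-*ˡ elems ⟨ ¬? (s ≈? 0#) ⟩ _)))))) ⟩
    ∑[ s ∈ elems ] ∑[ z ∈ elems ] ∑[ w ∈ elems ] (⟨ ¬? (s ≈? 0#) ⟩ * (⟨ s ⊗ z ≈? 0# ⟩ * ⟨ s ⊗ w ≈? 0# ⟩))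
      ≤⟨ ∑-mono elems (λ s → ∑-mono elems (λ z → ∑-mono elems (λ w → bound s z w))) ⟩
    ∑[ s ∈ elems ] ∑[ z ∈ elems ] ∑[ w ∈ elems ] (F s z w + F s w z)
      ≡⟨ ∑-cong elems (λ s → trans (∑-cong elems (λ z → ∑-+ elems _ _)) (∑-+ elems _ _)) ⟩
    ∑[ s ∈ elems ] ((∑[ z ∈ elems ] ∑[ w ∈ elems ] F s z w) + (∑[ z ∈ elems ] ∑[ w ∈ elems ] F s w z))
      ≡⟨ ∑-cong elems (λ s → cong (∑ elems (λ z → ∑ elems (F s z)) +_)
           (trans (∑-swap elems elems (λ z w → F s w z)) (sym (ℕₚ.+-identityʳ _)))) ⟩
    ∑[ s ∈ elems ] (2 * (∑[ z ∈ elems ] ∑[ w ∈ elems ] F s z w))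
      ≡⟨ ∑-*ˡ elems 2 _ ⟩
    2 * (∑[ s ∈ elems ] ∑[ z ∈ elems ] ∑[ w ∈ elems ] F s z w)
      ≤⟨ *-monoʳ-≤ 2 total ⟩
    2 * (μ * size) ∎
    where
    open ≤-Reasoning
    F : Carrier → Carrier → Carrier → ℕ
    F s z w = ⟨ z ~? 0# ⟩ * (⟨ z ⊗ s ≈? 0# ⟩ * ⟨ z ∣? w ⟩)
    one : {P Q S : Set} (P? : Dec P) (Q? : Dec Q) (S? : Dec S) → P → Q → S → 1 ≤ ⟨ P? ⟩ * (⟨ Q? ⟩ * ⟨ S? ⟩)
    one P? Q? S? p q s rewrite ⟨⟩-yes P? p | ⟨⟩-yes Q? q | ⟨⟩-yes S? s = ≤-refl
    bound : ∀ s z w → ⟨ ¬? (s ≈? 0#) ⟩ * (⟨ s ⊗ z ≈? 0# ⟩ * ⟨ s ⊗ w ≈? 0# ⟩) ≤ F s z w + F s w z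
    bound s z w with ¬? (s ≈? 0#) | s ⊗ z ≈? 0# | s ⊗ w ≈? 0#
    ... | no _    | _       | _       = z≤n
    ... | yes _   | no _    | _       = z≤n
    ... | yes _   | yes _   | no _    = z≤n
    ... | yes s≉0 | yes sz≈0 | yes sw≈0 with ∣-total z w
    ...   | inj₁ z∣w = ≤-trans (one (z ~? 0#) (z ⊗ s ≈? 0#) (z ∣? w)
              (NonUnit⇒~0 (zeroDivisor⇒NonUnit s≉0 sz≈0)) (≈-trans (*-comm z s) sz≈0) z∣w) (m≤m+n _ _)
    ...   | inj₂ w∣z = ≤-trans (one (w ~? 0#) (w ⊗ s ≈? 0#) (w ∣? z)
              (NonUnit⇒~0 (zeroDivisor⇒NonUnit s≉0 sw≈0)) (≈-trans (*-comm w s) sw≈0) w∣z) (m≤n+m _ (F s z w))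
    total : ∑[ s ∈ elems ] ∑[ z ∈ elems ] ∑[ w ∈ elems ] F s z w ≤ μ * size
    total = begin
      ∑[ s ∈ elems ] ∑[ z ∈ elems ] ∑[ w ∈ elems ] F s z w
        ≡⟨ ∑-swap elems elems _ ⟩
      ∑[ z ∈ elems ] ∑[ s ∈ elems ] ∑[ w ∈ elems ] F s z w
        ≡⟨ ∑-cong elems (λ z → trans (∑-cong elems (λ s → ∑-*ˡ elems ⟨ z ~? 0# ⟩ _)) (trans (∑-*ˡ elems ⟨ z ~? 0# ⟩ _)
             (cong (⟨ z ~? 0# ⟩ *_) (∑-product elems elems _ _)))) ⟩
      ∑[ z ∈ elems ] (⟨ z ~? 0# ⟩ * (ann z * multiples z))
        ≤⟨ ∑-mono elems (λ z → *-monoʳ-≤ ⟨ z ~? 0# ⟩ (ann*multiples≤size z)) ⟩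
      ∑[ z ∈ elems ] (⟨ z ~? 0# ⟩ * size)
        ≡⟨ ∑-*ʳ elems size _ ⟩
      μ * size ∎

  -- A nonzero `s` has `ann s ≤ μ`, which disposes of all factors but two. Two are kept because the
  -- sum for exponent 1 would grow with the length of the ring: there all valuations contribute
  -- equally, whereas from exponent 2 on the largest annihilators dominate.
  torsion-≤ : ∀ d → torsion (2 + d) ≤ 2 * (μ * size) * μ ^ d
  torsion-≤ d = begin
    torsion (2 + d)                                             ≤⟨ ∑-mono elems bound ⟩
    ∑[ s ∈ elems ] (⟨ ¬? (s ≈? 0#) ⟩ * ann s ^ 2 * μ ^ d)        ≡⟨ ∑-*ʳ elems (μ ^ d) _ ⟩
    torsion 2 * μ ^ d                                           ≤⟨ *-monoˡ-≤ (μ ^ d) torsion-2 ⟩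
    2 * (μ * size) * μ ^ d                                      ∎
    where
    open ≤-Reasoning
    bound : ∀ s → ⟨ ¬? (s ≈? 0#) ⟩ * ann s ^ (2 + d) ≤ ⟨ ¬? (s ≈? 0#) ⟩ * ann s ^ 2 * μ ^ d
    bound s with s ≈? 0#
    ... | yes _  = z≤n
    ... | no s≉0 = begin
      1 * ann s ^ (2 + d)             ≡⟨ cong (1 *_) (^-distribˡ-+-* (ann s) 2 d) ⟩
      1 * (ann s ^ 2 * ann s ^ d)     ≡⟨ ℕₚ.*-assoc 1 (ann s ^ 2) _ ⟨
      1 * ann s ^ 2 * ann s ^ d       ≤⟨ *-monoʳ-≤ (1 * ann s ^ 2) (^-monoˡ-≤ d (ann≤μ s≉0)) ⟩
      1 * ann s ^ 2 * μ ^ d           ∎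

  -- Independence modulo the maximal ideal

  -- y is independent of xs modulo the maximal ideal, in dual form.
  Independent : ∀ {d j} → Vec (Vec Carrier d) j → Vec Carrier d → Set
  Independent xs y = ∃ λ e → mul xs e ≋ 0ᵛ × e · y ≈ 1#

  independent? : ∀ {d j} (xs : Vec (Vec Carrier d) j) → Decidable₁ (Independent xs)
  independent? xs y = ∃-vec? (λ e → (mul xs e ≋? 0ᵛ) ×-dec (e · y ≈? 1#))
    (λ u≋v (p , q) → ≋-trans (mul-cong xs (≋-sym u≋v)) p , ≈-trans (·-congʳ y (≋-sym u≋v)) q)

  -- The dichotomy of linear algebra over the residue field, except that the dual vector of the
  -- first alternative is orthogonal to `xs` in R itself. Counting solutions over R requires this
  -- exact lift.
  Split : ∀ {d j} → Vec (Vec Carrier d) j → Set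
  Split xs = ∀ y → Independent xs y ⊎ (∃ λ c → y ~ᵛ comb c xs)

  Split-[] : ∀ {d} → Split {d} []
  Split-[] y with go y
    where
    go : ∀ {d} (y : Vec Carrier d) → (∃ λ e → e · y ≈ 1#) ⊎ y ~ᵛ 0ᵛ
    go []      = inj₂ []
    go (a ∷ y) with isUnit? a
    ... | yes (c , ac≈1) = inj₁ (c ∷ 0ᵛ , ≈-trans (+-cong (≈-trans (*-comm c a) ac≈1) (·-≋0ˡ y ≋-refl)) (+-identityʳ 1#))
    ... | no ¬u with go y
    ...   | inj₁ (e , ey≈1) = inj₁ (0# ∷ e , ≈-trans (+-cong (zeroˡ a) ey≈1) (+-identityˡ 1#))
    ...   | inj₂ y~0        = inj₂ (NonUnit⇒~0 ¬u ∷ y~0)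
  ... | inj₁ (e , ey≈1) = inj₁ (e , [] , ey≈1)
  ... | inj₂ y~0        = inj₂ ([] , y~0)

  -- A Gram-Schmidt step: `y` is projected along `x` by means of the dual vector `e₀` of `x`. A dual
  -- vector `e` of the projection is then corrected by a multiple of `e₀`, which makes it orthogonal
  -- to `x` and restores its value 1 on `y`.
  Split-∷ : ∀ {d j} {xs : Vec (Vec Carrier d) j} {x} → Split xs → Independent xs x → Split (x ∷ xs)
  Split-∷ {xs = xs} {x} split (e₀ , xse₀≋0 , e₀x≈1) y with split (y -ᵛ (e₀ · y) *ᵛ x)
  ... | inj₂ (c , y′~) = inj₂ ((e₀ · y) ∷ c ,
        κ.≋-trans (≋⇒~ᵛ (≋-trans (≋-sym (x-y+y≋x y ((e₀ · y) *ᵛ x))) (+ᵛ-comm _ _))) (κ.+ᵛ-cong κ.≋-refl y′~))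
  ... | inj₁ (e , xse≋0 , ey′≈1) = inj₁ (e -ᵛ (e · x) *ᵛ e₀ , e′⊥x ∷ e′⊥xs , e′y≈1)
    where
    open ≈-Reasoning
    e′⊥x : x · (e -ᵛ (e · x) *ᵛ e₀) ≈ 0#
    e′⊥x = ≈-trans (·--ʳ x e _) (x≈y⇒x-y≈0 (begin
      x · e                       ≈⟨ ·-comm x e ⟩
      e · x                       ≈⟨ *-identityʳ _ ⟨
      (e · x) ⊗ 1#                ≈⟨ *-congˡ (≈-trans (·-comm x e₀) e₀x≈1) ⟨
      (e · x) ⊗ (x · e₀)          ≈⟨ ·-*ʳ x (e · x) e₀ ⟨
      x · ((e · x) *ᵛ e₀)         ∎))
    e′⊥xs : mul xs (e -ᵛ (e · x) *ᵛ e₀) ≋ 0ᵛ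
    e′⊥xs = ≋-trans (mul-- xs e _) (≋0--ᵛ xse≋0 (≋-trans (mul-* xs (e · x) e₀) (≋0-*ᵛ (e · x) xse₀≋0)))
    e′y≈1 : (e -ᵛ (e · x) *ᵛ e₀) · y ≈ 1#
    e′y≈1 = begin
      (e -ᵛ (e · x) *ᵛ e₀) · y           ≈⟨ ·--ˡ e _ y ⟩
      (e · y) ⊖ ((e · x) *ᵛ e₀) · y      ≈⟨ +-congˡ (-‿cong (≈-trans (·-*ˡ (e · x) e₀ y) (*-comm _ _))) ⟩
      (e · y) ⊖ (e₀ · y) ⊗ (e · x)       ≈⟨ +-congˡ (-‿cong (·-*ʳ e (e₀ · y) x)) ⟨
      (e · y) ⊖ e · ((e₀ · y) *ᵛ x)      ≈⟨ ·--ʳ e y _ ⟨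
      e · (y -ᵛ (e₀ · y) *ᵛ x)           ≈⟨ ey′≈1 ⟩
      1#                                 ∎

  -- Equidistribution of dot products among the solutions

  solutions : ∀ {d j} → Vec (Vec Carrier d) j → Vec Carrier j → ℕ
  solutions {d} xs a = ∑[ x ∈ vecs d ] ⟨ mul xs x ≋? a ⟩

  ⟨mul-∷⟩ : ∀ {d j} (y : Vec Carrier d) (xs : Vec (Vec Carrier d) j) t a x →
            ⟨ mul (y ∷ xs) x ≋? (t ∷ a) ⟩ ≡ ⟨ mul xs x ≋? a ⟩ * ⟨ y · x ≈? t ⟩
  ⟨mul-∷⟩ y xs t a x = ⟨⟩-* (mul xs x ≋? a) (y · x ≈? t) (mul (y ∷ xs) x ≋? (t ∷ a)) PW.tail PW.head (λ p q → q ∷ p)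

  ⟨mul⟩-resp : ∀ {d j} (xs : Vec (Vec Carrier d) j) a → EnumVecs.Respects (λ x → ⟨ mul xs x ≋? a ⟩)
  ⟨mul⟩-resp xs a x≋y = ⟨⟩-cong (_ ≋? a) (_ ≋? a)
    (≋-trans (mul-cong xs (≋-sym x≋y))) (≋-trans (mul-cong xs x≋y))

  -- Averages the solutions over the translations by the multiples of e.
  size*solutions : ∀ {d j} (xs : Vec (Vec Carrier d) j) e y {γ} → mul xs e ≋ 0ᵛ → y · e ≈ γ → ∀ a t →
    size * solutions (y ∷ xs) (t ∷ a) ≡ ∑[ x ∈ vecs d ] (⟨ mul xs x ≋? a ⟩ * (∑[ ρ ∈ elems ] ⟨ (y · x) ⊕ γ ⊗ ρ ≈? t ⟩))
  size*solutions {d} xs e y {γ} xse≋0 ye≈γ a t = begin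
    size * solutions (y ∷ xs) (t ∷ a)
      ≡⟨ ∑-elems-const _ ⟨
    ∑[ _ ∈ elems ] solutions (y ∷ xs) (t ∷ a)
      ≡⟨ ∑-cong elems (λ ρ → ∑-shiftᵛ (⟨mul⟩-resp (y ∷ xs) (t ∷ a)) (ρ *ᵛ e)) ⟨
    ∑[ ρ ∈ elems ] ∑[ x ∈ vecs d ] ⟨ mul (y ∷ xs) (x +ᵛ ρ *ᵛ e) ≋? (t ∷ a) ⟩
      ≡⟨ ∑-cong elems (λ ρ → ∑-cong (vecs d) (shifted ρ)) ⟩
    ∑[ ρ ∈ elems ] ∑[ x ∈ vecs d ] (⟨ mul xs x ≋? a ⟩ * ⟨ (y · x) ⊕ γ ⊗ ρ ≈? t ⟩)
      ≡⟨ ∑-swap elems (vecs d) _ ⟩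
    ∑[ x ∈ vecs d ] ∑[ ρ ∈ elems ] (⟨ mul xs x ≋? a ⟩ * ⟨ (y · x) ⊕ γ ⊗ ρ ≈? t ⟩)
      ≡⟨ ∑-cong (vecs d) (λ x → ∑-*ˡ elems ⟨ mul xs x ≋? a ⟩ _) ⟩
    ∑[ x ∈ vecs d ] (⟨ mul xs x ≋? a ⟩ * (∑[ ρ ∈ elems ] ⟨ (y · x) ⊕ γ ⊗ ρ ≈? t ⟩)) ∎
    where
    open ≡-Reasoning
    xs-shift : ∀ ρ x → mul xs (x +ᵛ ρ *ᵛ e) ≋ mul xs x
    xs-shift ρ x = ≋-trans (mul-+ xs x _) (≋-trans
      (+ᵛ-cong ≋-refl (≋-trans (mul-* xs ρ e) (≋0-*ᵛ ρ xse≋0))) (+ᵛ-identityʳ _))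
    y-shift : ∀ ρ x → y · (x +ᵛ ρ *ᵛ e) ≈ (y · x) ⊕ γ ⊗ ρ
    y-shift ρ x = ≈-trans (·-+ʳ y x _) (+-congˡ (≈-trans (·-*ʳ y ρ e) (≈-trans (*-congˡ ye≈γ) (*-comm ρ γ))))
    shifted : ∀ ρ x → ⟨ mul (y ∷ xs) (x +ᵛ ρ *ᵛ e) ≋? (t ∷ a) ⟩ ≡ ⟨ mul xs x ≋? a ⟩ * ⟨ (y · x) ⊕ γ ⊗ ρ ≈? t ⟩
    shifted ρ x = ⟨⟩-* (mul xs x ≋? a) ((y · x) ⊕ γ ⊗ ρ ≈? t) (mul (y ∷ xs) (x +ᵛ ρ *ᵛ e) ≋? (t ∷ a))
      (λ p → ≋-trans (≋-sym (xs-shift ρ x)) (PW.tail p)) (λ p → ≈-trans (≈-sym (y-shift ρ x)) (PW.head p))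
      (λ p q → ≈-trans (y-shift ρ x) q ∷ ≋-trans (xs-shift ρ x) p)

  -- Every line in the direction `e` stays among the solutions for `xs` and meets `y · x ≈ t`
  -- exactly once, since `e · y ≈ 1#`.
  solutions-∷ : ∀ {d j} (xs : Vec (Vec Carrier d) j) {y} → Independent xs y → ∀ a t →
                size * solutions (y ∷ xs) (t ∷ a) ≡ solutions xs a
  solutions-∷ {d} xs {y} (e , xse≋0 , ey≈1) a t =
    trans (size*solutions xs e y xse≋0 (≈-trans (·-comm y e) ey≈1) a t) (∑-cong (vecs d) λ x →
      trans (cong (⟨ mul xs x ≋? a ⟩ *_) (trans
        (∑-cong elems (λ ρ → ⟨⟩-cong ((y · x) ⊕ 1# ⊗ ρ ≈? t) (t ⊖ (y · x) ≈? ρ) (to x ρ) (from x ρ)))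
        (∑-elems-≈ (t ⊖ (y · x))))) (ℕₚ.*-identityʳ _))
    where
    to : ∀ x ρ → (y · x) ⊕ 1# ⊗ ρ ≈ t → t ⊖ (y · x) ≈ ρ
    to x ρ p = ≈-trans (+-congʳ (≈-trans (≈-sym p) (≈-trans (+-comm _ _) (+-congʳ (*-identityˡ ρ))))) (x+y-y≈x ρ _)
    from : ∀ x ρ → t ⊖ (y · x) ≈ ρ → (y · x) ⊕ 1# ⊗ ρ ≈ t
    from x ρ p = ≈-trans (+-comm _ _) (≈-trans (+-congʳ (≈-trans (*-identityˡ ρ) (≈-sym p))) (x-y+y≈x t _))

  annᵛ : ∀ {d} → Vec Carrier d → ℕ
  annᵛ z = ∑[ s ∈ elems ] ⟨ s *ᵛ z ≋? 0ᵛ ⟩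

  solutions-∷-≤ : ∀ {d j} (y : Vec Carrier d) (xs : Vec (Vec Carrier d) j) t a →
                  solutions (y ∷ xs) (t ∷ a) ≤ solutions xs a
  solutions-∷-≤ {d} y xs t a = ∑-mono (vecs d) (λ x → ⟨⟩-mono (_ ≋? (t ∷ a)) (_ ≋? a) PW.tail)

  γ*ᵛ≋0⇒~0 : ∀ {d γ} {w : Vec Carrier d} → ¬ γ ≈ 0# → γ *ᵛ w ≋ 0ᵛ → w ~ᵛ 0ᵛ
  γ*ᵛ≋0⇒~0 {w = []}    γ≉0 []      = []
  γ*ᵛ≋0⇒~0 {w = _ ∷ _} γ≉0 (p ∷ P) = NonUnit⇒~0 (zeroDivisor⇒NonUnit γ≉0 p) ∷ γ*ᵛ≋0⇒~0 γ≉0 P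

  -- Write y′ - y = γ z′ with z′ primitive: if there is a common solution at all, the kernel condition
  -- makes z′ independent of y ∷ xs, so that x · (y′ - y) is equidistributed in the ideal of γ.
  solutions-pair : ∀ {d j} (xs : Vec (Vec Carrier d) j) {a b t} → Split xs → κ.Ker xs a b t →
                   ∀ {y y′} → Independent xs y → mul xs y ≋ b → mul xs y′ ≋ b →
                   size * solutions (y′ ∷ y ∷ xs) (t ∷ t ∷ a) ≤ solutions (y ∷ xs) (t ∷ a) * annᵛ (y′ -ᵛ y)
  solutions-pair {d} xs {a} {b} {t} split ker {y} {y′} ind yb y′b
    with primitivePart (y′ -ᵛ y)
  ... | inj₁ z≋0 = begin
      size * solutions (y′ ∷ y ∷ xs) (t ∷ t ∷ a)      ≤⟨ *-monoʳ-≤ size (solutions-∷-≤ y′ (y ∷ xs) t (t ∷ a)) ⟩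
      size * solutions (y ∷ xs) (t ∷ a)               ≡⟨ ℕₚ.*-comm size _ ⟩
      solutions (y ∷ xs) (t ∷ a) * size               ≡⟨ cong (solutions (y ∷ xs) (t ∷ a) *_)
          (trans (∑-cong elems (λ s → ⟨⟩-yes (_ ≋? 0ᵛ) (≋0-*ᵛ s z≋0))) (trans (∑-elems-const 1) (ℕₚ.*-identityʳ size))) ⟨
      solutions (y ∷ xs) (t ∷ a) * annᵛ (y′ -ᵛ y)     ∎
    where open ≤-Reasoning
  ... | inj₂ (γ , z′ , z≋γz′ , γ≉0 , z′≁0) with solutions (y′ ∷ y ∷ xs) (t ∷ t ∷ a) in eq
  ...   | zero  = ≤-trans (≤-reflexive (*-zeroʳ size)) z≤n
  ...   | suc n = subst (λ m → size * m ≤ solutions (y ∷ xs) (t ∷ a) * annᵛ (y′ -ᵛ y)) eq nonempty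
    where
    module _ {x} (y′x≈t : y′ · x ≈ t) (yx≈t : y · x ≈ t) (xsx≋a : mul xs x ≋ a) where
      -- Multiplied by `γ`, the dot products of `z′` with `xs` and `x` become those of `y′ - y`,
      -- which are 0. As `γ` is nonzero they are non-units, so modulo the maximal ideal a
      -- combination `z′` would come from a kernel vector of the bordered matrix.
      impossible : ∀ γ′ c → ¬ (z′ ~ᵛ comb (γ′ ∷ c) (y ∷ xs))
      impossible γ′ c z′~ = z′≁0 (κ.Ker⇒≋0 ker {γ = γ′} {c} (≋⇒~ᵛ xsx≋a) (≋⇒~ᵛ yb) (≈⇒~ (≈-trans (·-comm x y) yx≈t))
        (γ*ᵛ≋0⇒~0 γ≉0 (≋-trans (≋-sym (mul-* xs γ z′)) (≋-trans (mul-cong xs (≋-sym z≋γz′))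
          (≋-trans (mul-- xs y′ y) (x≋y⇒x-y≋0 (≋-trans y′b (≋-sym yb)))))))
        (NonUnit⇒~0 (zeroDivisor⇒NonUnit γ≉0 (≈-trans (≈-sym (·-*ʳ x γ z′)) (≈-trans (·-congˡ x (≋-sym z≋γz′))
          (≈-trans (·--ʳ x y′ y) (x≈y⇒x-y≈0 (≈-trans (≈-trans (·-comm x y′) y′x≈t) (≈-sym (≈-trans (·-comm x y) yx≈t)))))))))
        z′~)
    direction : Independent (y ∷ xs) z′
    direction with ∑-pos⇒∃ (vecs d) (λ x → ⟨ mul (y′ ∷ y ∷ xs) x ≋? (t ∷ t ∷ a) ⟩) (λ ≡0 → case trans (sym eq) ≡0 of λ ())
    ... | x , _ , ≢0 with mul (y′ ∷ y ∷ xs) x ≋? (t ∷ t ∷ a)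
    ...   | no _ = ⊥-elim (≢0 refl)
    ...   | yes (p ∷ q ∷ r) with Split-∷ split ind z′
    ...     | inj₁ i = i
    ...     | inj₂ (γ′ ∷ c , z′~) = ⊥-elim (impossible p q r γ′ c z′~)
    v = proj₁ direction
    y′v≈γ : y′ · v ≈ γ
    y′v≈γ = begin
      y′ · v                        ≈⟨ ·-congʳ v (x-y+y≋x y′ y) ⟨
      (y′ -ᵛ y +ᵛ y) · v            ≈⟨ ·-+ˡ (y′ -ᵛ y) y v ⟩
      ((y′ -ᵛ y) · v) ⊕ (y · v)     ≈⟨ +-cong (·-congʳ v z≋γz′) (PW.head (proj₁ (proj₂ direction))) ⟩
      ((γ *ᵛ z′) · v) ⊕ 0#          ≈⟨ +-identityʳ _ ⟩
      (γ *ᵛ z′) · v                 ≈⟨ ·-*ˡ γ z′ v ⟩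
      γ ⊗ (z′ · v)                  ≈⟨ *-congˡ (≈-trans (·-comm z′ v) (proj₂ (proj₂ direction))) ⟩
      γ ⊗ 1#                        ≈⟨ *-identityʳ γ ⟩
      γ                             ∎
      where open ≈-Reasoning
    open ≤-Reasoning
    nonempty : size * solutions (y′ ∷ y ∷ xs) (t ∷ t ∷ a) ≤ solutions (y ∷ xs) (t ∷ a) * annᵛ (y′ -ᵛ y)
    nonempty = begin
      size * solutions (y′ ∷ y ∷ xs) (t ∷ t ∷ a)
        ≡⟨ size*solutions (y ∷ xs) v y′ (proj₁ (proj₂ direction)) y′v≈γ (t ∷ a) t ⟩
      ∑[ x ∈ vecs d ] (⟨ mul (y ∷ xs) x ≋? (t ∷ a) ⟩ * (∑[ ρ ∈ elems ] ⟨ (y′ · x) ⊕ γ ⊗ ρ ≈? t ⟩))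
        ≤⟨ ∑-mono (vecs d) (λ x → *-monoʳ-≤ ⟨ mul (y ∷ xs) x ≋? (t ∷ a) ⟩ (≤-trans (ann-≤ (y′ · x) γ t) annγ≤)) ⟩
      ∑[ x ∈ vecs d ] (⟨ mul (y ∷ xs) x ≋? (t ∷ a) ⟩ * annᵛ (y′ -ᵛ y))
        ≡⟨ ∑-*ʳ (vecs d) (annᵛ (y′ -ᵛ y)) _ ⟩
      solutions (y ∷ xs) (t ∷ a) * annᵛ (y′ -ᵛ y) ∎
      where
      annγ≤ : ann γ ≤ annᵛ (y′ -ᵛ y)
      annγ≤ = ∑-mono elems (λ s → ⟨⟩-mono (γ ⊗ s ≈? 0#) (s *ᵛ (y′ -ᵛ y) ≋? 0ᵛ) (λ γs≈0 →
        ≋-trans (*ᵛ-cong ≈-refl z≋γz′) (≋-trans (≋-sym (*ᵛ-assoc s γ z′))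
          (≋-trans (*ᵛ-cong (≈-trans (*-comm s γ) γs≈0) ≋-refl) (*ᵛ-zeroˡ z′)))))

  -- The sum is taken over the annihilating scalars first: `s = 0` admits every point of `B`, and
  -- any other `s` at most `ann s ^ d` of them, because the differences `y′ - y` are distinct.
  ∑-annᵛ-≤ : ∀ {d} {B : List (Vec Carrier d)} → IsFinSet R B → ∀ y →
             ∑[ y′ ∈ B ] annᵛ (y′ -ᵛ y) ≤ length B + torsion d
  ∑-annᵛ-≤ {d} {B} B! y = begin
    ∑[ y′ ∈ B ] annᵛ (y′ -ᵛ y)                                       ≡⟨ ∑-swap B elems _ ⟩
    ∑[ s ∈ elems ] ∑[ y′ ∈ B ] ⟨ s *ᵛ (y′ -ᵛ y) ≋? 0ᵛ ⟩              ≤⟨ ∑-mono elems bound ⟩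
    ∑[ s ∈ elems ] (⟨ 0# ≈? s ⟩ * length B + ⟨ ¬? (s ≈? 0#) ⟩ * ann s ^ d)
                                                                     ≡⟨ ∑-+ elems _ _ ⟩
    ∑ elems (λ s → ⟨ 0# ≈? s ⟩ * length B) + torsion d               ≡⟨ cong (_+ torsion d) (trans (∑-*ʳ elems (length B) _)
                                                                         (trans (cong (_* length B) (∑-elems-≈ 0#)) (ℕₚ.*-identityˡ _))) ⟩
    length B + torsion d                                             ∎
    where
    open ≤-Reasoning
    resp : ∀ s → EnumVecs.Respects {d} (λ u → ⟨ s *ᵛ (u -ᵛ y) ≋? 0ᵛ ⟩)
    resp s u≋v = ⟨⟩-cong (_ ≋? 0ᵛ) (_ ≋? 0ᵛ)
      (≋-trans (*ᵛ-cong ≈-refl (-ᵛ-cong (≋-sym u≋v) ≋-refl))) (≋-trans (*ᵛ-cong ≈-refl (-ᵛ-cong u≋v ≋-refl)))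
    bound : ∀ s → ∑[ y′ ∈ B ] ⟨ s *ᵛ (y′ -ᵛ y) ≋? 0ᵛ ⟩ ≤ ⟨ 0# ≈? s ⟩ * length B + ⟨ ¬? (s ≈? 0#) ⟩ * ann s ^ d
    bound s with s ≈? 0#
    ... | yes s≈0 = begin
      ∑[ y′ ∈ B ] ⟨ s *ᵛ (y′ -ᵛ y) ≋? 0ᵛ ⟩    ≤⟨ ∑-mono B (λ y′ → ⟨⟩-≤1 (s *ᵛ (y′ -ᵛ y) ≋? 0ᵛ)) ⟩
      ∑[ _ ∈ B ] 1                            ≡⟨ trans (∑-const B 1) (ℕₚ.*-comm _ 1) ⟩
      1 * length B                            ≡⟨ cong (_* length B) (⟨⟩-yes (0# ≈? s) (≈-sym s≈0)) ⟨
      ⟨ 0# ≈? s ⟩ * length B                  ≤⟨ m≤m+n _ _ ⟩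
      ⟨ 0# ≈? s ⟩ * length B + 0              ∎
    ... | no s≉0 = begin
      ∑[ y′ ∈ B ] ⟨ s *ᵛ (y′ -ᵛ y) ≋? 0ᵛ ⟩               ≤⟨ ∑-distinct-≤ (resp s) B! ⟩
      ∑[ u ∈ vecs d ] ⟨ s *ᵛ (u -ᵛ y) ≋? 0ᵛ ⟩            ≡⟨ ∑-shiftᵛ (resp s) y ⟨
      ∑[ u ∈ vecs d ] ⟨ s *ᵛ (u +ᵛ y -ᵛ y) ≋? 0ᵛ ⟩       ≡⟨ ∑-cong (vecs d) (λ u → ⟨⟩-cong (_ ≋? 0ᵛ) (s *ᵛ u ≋? 0ᵛ)
                                                              (≋-trans (*ᵛ-cong ≈-refl (≋-sym (x+y-y≋x u y))))
                                                              (≋-trans (*ᵛ-cong ≈-refl (x+y-y≋x u y)))) ⟩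
      ∑[ u ∈ vecs d ] ⟨ s *ᵛ u ≋? 0ᵛ ⟩                   ≡⟨ ∑-annᵛ s d ⟩
      ann s ^ d                                          ≡⟨ ℕₚ.+-identityʳ _ ⟨
      1 * ann s ^ d                                      ≤⟨ m≤n+m _ (⟨ 0# ≈? s ⟩ * length B) ⟩
      ⟨ 0# ≈? s ⟩ * length B + 1 * ann s ^ d             ∎

  -- The second moment and Chebyshev's inequality

  module VarianceArithmetic where
    open +-*-Solver
    open ≤-Reasoning

    -- If `2 * n < β`, then β² ≤ 4 (β - n)². The square is expanded and its cross term moved to the
    -- left to avoid subtraction.
    variance-pointwise : ∀ n β → β * β * ⟨ ¬? (β ≤? 2 * n) ⟩ + 8 * (n * β) ≤ 4 * (n * n) + 4 * (β * β)
    variance-pointwise n β with β ≤? 2 * n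
    ... | no β≰2n with ℕₚ.m≤n⇒∃[o]m+o≡n (ℕₚ.<⇒≤ (ℕₚ.≰⇒> β≰2n))
    ...   | δ , refl = ≤-trans (m≤m+n _ (4 * (n * δ) + 3 * (δ * δ))) (≤-reflexive (solve 2 (λ n δ →
            ((con 2 :* n :+ δ) :* (con 2 :* n :+ δ) :* con 1 :+ con 8 :* (n :* (con 2 :* n :+ δ)))
              :+ (con 4 :* (n :* δ) :+ con 3 :* (δ :* δ))
            := con 4 :* (n :* n) :+ con 4 :* ((con 2 :* n :+ δ) :* (con 2 :* n :+ δ))) refl n δ))
    variance-pointwise n β | yes _ rewrite *-zeroʳ (β * β) with ℕₚ.≤-total n β
    ... | inj₁ n≤β with ℕₚ.m≤n⇒∃[o]m+o≡n n≤β
    ...   | δ , refl = ≤-trans (m≤m+n _ (4 * (δ * δ))) (≤-reflexive (solve 2 (λ n δ →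
            con 8 :* (n :* (n :+ δ)) :+ con 4 :* (δ :* δ)
            := con 4 :* (n :* n) :+ con 4 :* ((n :+ δ) :* (n :+ δ))) refl n δ))
    variance-pointwise n β | yes _ | inj₂ β≤n with ℕₚ.m≤n⇒∃[o]m+o≡n β≤n
    ...   | δ , refl = ≤-trans (m≤m+n _ (4 * (δ * δ))) (≤-reflexive (solve 2 (λ β δ →
            con 8 :* ((β :+ δ) :* β) :+ con 4 :* (δ :* δ)
            := con 4 :* ((β :+ δ) :* (β :+ δ)) :+ con 4 :* (β :* β)) refl β δ))

    variance-weighted : ∀ H N ν β → β * β * (H * ⟨ ¬? (β ≤? 2 * (N * ν)) ⟩) + 8 * (N * β) * (H * ν)
                                  ≤ 4 * (N * N) * (H * (ν * ν)) + 4 * (β * β) * H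
    variance-weighted H N ν β = begin
      β * β * (H * e) + 8 * (N * β) * (H * ν)
        ≡⟨ solve 5 (λ β H e N ν → β :* β :* (H :* e) :+ con 8 :* (N :* β) :* (H :* ν)
                     := H :* (β :* β :* e :+ con 8 :* ((N :* ν) :* β))) refl β H e N ν ⟩
      H * (β * β * e + 8 * ((N * ν) * β))
        ≤⟨ *-monoʳ-≤ H (variance-pointwise (N * ν) β) ⟩
      H * (4 * ((N * ν) * (N * ν)) + 4 * (β * β))
        ≡⟨ solve 4 (λ β H N ν → H :* (con 4 :* ((N :* ν) :* (N :* ν)) :+ con 4 :* (β :* β))
                     := con 4 :* (N :* N) :* (H :* (ν :* ν)) :+ con 4 :* (β :* β) :* H) refl β H N ν ⟩
      4 * (N * N) * (H * (ν * ν)) + 4 * (β * β) * H ∎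
      where e = ⟨ ¬? (β ≤? 2 * (N * ν)) ⟩

    -- With the two moments inserted, the main terms 8 β² h cancel and only the torsion excess
    -- remains. A factor β is then cancelled, which is why β = 0 is treated apart.
    variance-bound : ∀ N β h T X M₁ M₂ → N * M₁ ≡ β * h → N * (N * M₂) ≤ β * (h * (β + T)) →
                     β * β * X + 8 * (N * β) * M₁ ≤ 4 * (N * N) * M₂ + 4 * (β * β) * h →
                     β * X ≤ 4 * (h * T)
    variance-bound N zero    h T X M₁ M₂ p q v = z≤n
    variance-bound N (suc n) h T X M₁ M₂ p q v = ℕₚ.*-cancelˡ-≤ β (ℕₚ.+-cancelʳ-≤ (8 * (β * (β * h))) _ _ (begin
      β * (β * X) + 8 * (β * (β * h))
        ≡⟨ cong (λ m → β * (β * X) + 8 * (β * m)) p ⟨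
      β * (β * X) + 8 * (β * (N * M₁))
        ≡⟨ solve 4 (λ β X N M → β :* (β :* X) :+ con 8 :* (β :* (N :* M))
                     := β :* β :* X :+ con 8 :* (N :* β) :* M) refl β X N M₁ ⟩
      β * β * X + 8 * (N * β) * M₁
        ≤⟨ v ⟩
      4 * (N * N) * M₂ + 4 * (β * β) * h
        ≡⟨ cong (_+ 4 * (β * β) * h) (solve 2 (λ N M → con 4 :* (N :* N) :* M := con 4 :* (N :* (N :* M))) refl N M₂) ⟩
      4 * (N * (N * M₂)) + 4 * (β * β) * h
        ≤⟨ ℕₚ.+-monoˡ-≤ _ (*-monoʳ-≤ 4 q) ⟩
      4 * (β * (h * (β + T))) + 4 * (β * β) * h
        ≡⟨ solve 3 (λ β h T → con 4 :* (β :* (h :* (β :+ T))) :+ con 4 :* (β :* β) :* h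
                     := β :* (con 4 :* (h :* T)) :+ con 8 :* (β :* (β :* h))) refl β h T ⟩
      β * (4 * (h * T)) + 8 * (β * (β * h)) ∎))
      where β = suc n

  module SecondMoment {d j} (xs : Vec (Vec Carrier d) j) {a b t} (split : Split xs) (ker : κ.Ker xs a b t)
                      {B : List (Vec Carrier d)} (B! : IsFinSet R B)
                      (ind : ∀ {y} → y ∈ B → Independent xs y) (Bb : ∀ {y} → y ∈ B → mul xs y ≋ b) where

    ν : Vec Carrier d → ℕ
    ν x = ∑[ y ∈ B ] ⟨ y · x ≈? t ⟩

    exceptional : Vec Carrier d → ℕ
    exceptional x = ⟨ ¬? (length B ≤? 2 * (size * ν x)) ⟩

    ν-resp : EnumVecs.Respects ν
    ν-resp x≋x′ = ∑-cong B (λ y → ⟨⟩-cong (_ ≈? t) (_ ≈? t)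
      (≈-trans (·-congˡ y (≋-sym x≋x′))) (≈-trans (·-congˡ y x≋x′)))

    private
      β h : ℕ
      β = length B
      h = solutions xs a
      H : Vec Carrier d → ℕ
      H x = ⟨ mul xs x ≋? a ⟩

    H*ν : ∀ x → H x * ν x ≡ ∑[ y ∈ B ] ⟨ mul (y ∷ xs) x ≋? (t ∷ a) ⟩
    H*ν x = trans (sym (∑-*ˡ B (H x) _)) (∑-cong B (λ y → sym (⟨mul-∷⟩ y xs t a x)))

    firstMoment : size * (∑[ x ∈ vecs d ] (H x * ν x)) ≡ β * h
    firstMoment = begin
      size * (∑[ x ∈ vecs d ] (H x * ν x))             ≡⟨ cong (size *_) (trans (∑-cong (vecs d) H*ν) (∑-swap (vecs d) B _)) ⟩
      size * (∑[ y ∈ B ] solutions (y ∷ xs) (t ∷ a))   ≡⟨ ∑-*ˡ B size _ ⟨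
      ∑[ y ∈ B ] (size * solutions (y ∷ xs) (t ∷ a))   ≡⟨ ∑-cong-∈ B (λ y∈B → solutions-∷ xs (ind y∈B) a t) ⟩
      ∑[ _ ∈ B ] h                                     ≡⟨ ∑-const B h ⟩
      β * h                                            ∎
      where open ≡-Reasoning

    H*ν*ν : ∀ x → H x * (ν x * ν x) ≡ ∑[ y ∈ B ] ∑[ y′ ∈ B ] ⟨ mul (y′ ∷ y ∷ xs) x ≋? (t ∷ t ∷ a) ⟩
    H*ν*ν x = begin
      H x * (ν x * ν x)                                                       ≡⟨ ℕₚ.*-assoc (H x) (ν x) (ν x) ⟨
      H x * ν x * ν x                                                         ≡⟨ cong (_* ν x) (H*ν x) ⟩
      ∑ B (λ y → ⟨ mul (y ∷ xs) x ≋? (t ∷ a) ⟩) * ν x                         ≡⟨ ∑-product B B _ _ ⟨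
      ∑[ y ∈ B ] ∑[ y′ ∈ B ] (⟨ mul (y ∷ xs) x ≋? (t ∷ a) ⟩ * ⟨ y′ · x ≈? t ⟩)  ≡⟨ ∑-cong B (λ y → ∑-cong B (λ y′ → ⟨mul-∷⟩ y′ (y ∷ xs) t (t ∷ a) x)) ⟨
      ∑[ y ∈ B ] ∑[ y′ ∈ B ] ⟨ mul (y′ ∷ y ∷ xs) x ≋? (t ∷ t ∷ a) ⟩           ∎
      where open ≡-Reasoning

    -- One factor `size` is absorbed by the second point of a pair through `solutions-pair`, the
    -- other by the first point through `solutions-∷`. In between, the annihilators are summed over
    -- the second point.
    secondMoment : size * (size * (∑[ x ∈ vecs d ] (H x * (ν x * ν x)))) ≤ β * (h * (β + torsion d))
    secondMoment = begin
      size * (size * (∑[ x ∈ vecs d ] (H x * (ν x * ν x))))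
        ≡⟨ cong (λ n → size * (size * n)) (trans (∑-cong (vecs d) H*ν*ν) (trans (∑-swap (vecs d) B _)
             (∑-cong B (λ y → ∑-swap (vecs d) B _)))) ⟩
      size * (size * (∑[ y ∈ B ] ∑[ y′ ∈ B ] solutions (y′ ∷ y ∷ xs) (t ∷ t ∷ a)))
        ≡⟨ cong (size *_) (trans (sym (∑-*ˡ B size _)) (∑-cong B (λ y → sym (∑-*ˡ B size _)))) ⟩
      size * (∑[ y ∈ B ] ∑[ y′ ∈ B ] (size * solutions (y′ ∷ y ∷ xs) (t ∷ t ∷ a)))
        ≤⟨ *-monoʳ-≤ size (∑-mono-∈ B (λ {y} y∈B → ≤-trans
             (∑-mono-∈ B (λ y′∈B → solutions-pair xs split ker (ind y∈B) (Bb y∈B) (Bb y′∈B)))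
             (≤-trans (≤-reflexive (∑-*ˡ B (solutions (y ∷ xs) (t ∷ a)) _))
                      (*-monoʳ-≤ (solutions (y ∷ xs) (t ∷ a)) (∑-annᵛ-≤ B! y))))) ⟩
      size * (∑[ y ∈ B ] (solutions (y ∷ xs) (t ∷ a) * (β + torsion d)))
        ≡⟨ ∑-*ˡ B size _ ⟨
      ∑[ y ∈ B ] (size * (solutions (y ∷ xs) (t ∷ a) * (β + torsion d)))
        ≡⟨ ∑-cong-∈ B (λ {y} y∈B → trans (sym (ℕₚ.*-assoc size (solutions (y ∷ xs) (t ∷ a)) (β + torsion d)))
             (cong (_* (β + torsion d)) (solutions-∷ xs (ind y∈B) a t))) ⟩
      ∑[ _ ∈ B ] (h * (β + torsion d))
        ≡⟨ ∑-const B _ ⟩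
      β * (h * (β + torsion d)) ∎
      where open ≤-Reasoning

    private
      X : ℕ
      X = ∑[ x ∈ vecs d ] (H x * exceptional x)

    chebyshev : β * X ≤ 4 * (h * torsion d)
    chebyshev = VarianceArithmetic.variance-bound size β h (torsion d) X M₁ M₂ firstMoment secondMoment (begin
      β * β * X + 8 * (size * β) * M₁
        ≡⟨ cong₂ _+_ (∑-*ˡ (vecs d) (β * β) _) (∑-*ˡ (vecs d) (8 * (size * β)) _) ⟨
      (∑[ x ∈ vecs d ] (β * β * (H x * exceptional x))) + (∑[ x ∈ vecs d ] (8 * (size * β) * (H x * ν x)))
        ≡⟨ ∑-+ (vecs d) _ _ ⟨
      ∑[ x ∈ vecs d ] (β * β * (H x * exceptional x) + 8 * (size * β) * (H x * ν x))
        ≤⟨ ∑-mono (vecs d) (λ x → VarianceArithmetic.variance-weighted (H x) size (ν x) β) ⟩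
      ∑[ x ∈ vecs d ] (4 * (size * size) * (H x * (ν x * ν x)) + 4 * (β * β) * H x)
        ≡⟨ trans (∑-+ (vecs d) _ _) (cong₂ _+_ (∑-*ˡ (vecs d) (4 * (size * size)) _) (∑-*ˡ (vecs d) (4 * (β * β)) H)) ⟩
      4 * (size * size) * M₂ + 4 * (β * β) * h ∎)
      where
      open ≤-Reasoning
      M₁ = ∑[ x ∈ vecs d ] (H x * ν x)
      M₂ = ∑[ x ∈ vecs d ] (H x * (ν x * ν x))

    -- Chebyshev's inequality is applied to all solutions in Rᵈ, among which the candidates `A` have
    -- no structure; passing to `A` only drops nonnegative terms.
    exceptional-few : {A : List (Vec Carrier d)} → IsFinSet R A → (∀ {x} → x ∈ A → mul xs x ≋ a) →
                      β * ∑ A exceptional ≤ 4 * (h * torsion d)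
    exceptional-few {A} A! Aa = ≤-trans (*-monoʳ-≤ β (≤-trans
        (≤-reflexive (∑-cong-∈ A (λ {x} x∈A → sym (trans (cong (_* exceptional x) (⟨⟩-yes (mul xs x ≋? a) (Aa x∈A))) (ℕₚ.*-identityˡ _)))))
        (∑-distinct-≤ (λ x≋y → cong₂ _*_ (⟨mul⟩-resp xs a x≋y)
          (cong (λ n → ⟨ ¬? (β ≤? 2 * (size * n)) ⟩) (ν-resp x≋y))) A!)))
      chebyshev

  -- Dependent points, the choice of a point, and admissible values

  -- All dependent points of B are congruent modulo the maximal ideal.
  dependent-few : ∀ {d j} (xs : Vec (Vec Carrier d) j) {b} → Split xs → κ.Nondeg xs b →
                  {B : List (Vec Carrier d)} → IsFinSet R B → (∀ {y} → y ∈ B → mul xs y ≋ b) →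
                  length B ≤ length (filter (independent? xs) B) + μ ^ d
  dependent-few {d} xs {b} split nondeg {B} B! Bb = begin
    length B
      ≡⟨ trans (sym (ℕₚ.*-identityʳ (length B))) (sym (∑-const B 1)) ⟩
    ∑[ _ ∈ B ] 1
      ≡⟨ ∑-cong B (λ y → sym (complement y)) ⟩
    ∑[ y ∈ B ] (⟨ independent? xs y ⟩ + ⟨ ¬? (independent? xs y) ⟩)
      ≡⟨ ∑-+ B _ _ ⟩
    ∑ B (λ y → ⟨ independent? xs y ⟩) + ∑ B (λ y → ⟨ ¬? (independent? xs y) ⟩)
      ≤⟨ ℕₚ.+-mono-≤ (≤-reflexive (sym (length-filter-∑ (independent? xs) B))) bound ⟩
    length (filter (independent? xs) B) + μ ^ d ∎
    where
    open ≤-Reasoning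
    complement : ∀ y → ⟨ independent? xs y ⟩ + ⟨ ¬? (independent? xs y) ⟩ ≡ 1
    complement y with independent? xs y
    ... | yes _ = refl
    ... | no _  = refl
    congruent : ∀ {y y′} → y ∈ B → y′ ∈ B → ¬ Independent xs y → ¬ Independent xs y′ → y ~ᵛ y′
    congruent {y} {y′} y∈ y′∈ ¬i ¬i′ with split y | split y′
    ... | inj₁ i       | _              = ⊥-elim (¬i i)
    ... | inj₂ _       | inj₁ i′        = ⊥-elim (¬i′ i′)
    ... | inj₂ (c , p) | inj₂ (c′ , p′) =
      κ.comb-unique nondeg {c = c} {c′} (≋⇒~ᵛ (Bb y∈)) (≋⇒~ᵛ (Bb y′∈)) p p′
    bound : ∑[ y ∈ B ] ⟨ ¬? (independent? xs y) ⟩ ≤ μ ^ d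
    bound with ∑ B (λ y → ⟨ ¬? (independent? xs y) ⟩) in eq
    ... | zero  = z≤n
    ... | suc n with ∑-pos⇒∃ B (λ y → ⟨ ¬? (independent? xs y) ⟩) (λ ≡0 → case trans (sym eq) ≡0 of λ ())
    ...   | y₀ , y₀∈B , ≢0 with independent? xs y₀
    ...     | yes _ = ⊥-elim (≢0 refl)
    ...     | no ¬i₀ = begin
      suc n                                        ≡⟨ eq ⟨
      ∑[ y ∈ B ] ⟨ ¬? (independent? xs y) ⟩        ≤⟨ ∑-mono-∈ B (λ {y} y∈B → ⟨⟩-mono (¬? (independent? xs y)) (y ~ᵛ? y₀)
                                                        (λ ¬i → congruent y∈B y₀∈B ¬i ¬i₀)) ⟩
      ∑[ y ∈ B ] ⟨ y ~ᵛ? y₀ ⟩                      ≤⟨ ∑-distinct-≤ (λ {x} {y} x≋y → ⟨⟩-cong (x ~ᵛ? y₀) (y ~ᵛ? y₀)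
                                                        (κ.≋-trans (κ.≋-sym (≋⇒~ᵛ x≋y))) (κ.≋-trans (≋⇒~ᵛ x≋y))) B! ⟩
      ∑[ y ∈ vecs d ] ⟨ y ~ᵛ? y₀ ⟩                 ≡⟨ ∑-residueClassᵛ y₀ ⟩
      μ ^ d                                        ∎

  -- The union bound: at most k properties, each failing on at most a fraction 1 / (k+1) of a
  -- nonempty list, hold together somewhere.
  choose : {A : Set} {n k : ℕ} {P : Fin n → A → Set} (P? : ∀ i → Decidable₁ (P i)) (L : List A) → 0 < length L → n ≤ k →
           (∀ i → suc k * (∑[ x ∈ L ] ⟨ ¬? (P? i x) ⟩) ≤ length L) → ∃ λ x → x ∈ L × (∀ i → P i x)
  choose {n = n} {k} P? L 0<L n≤k few with Any.any? (λ x → all? (λ i → P? i x)) L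
  ... | yes p = find p
  ... | no ¬p = ⊥-elim (ℕₚ.<-irrefl refl (begin-strict
    n * length L                                                         <⟨ ℕₚ.*-monoˡ-< (length L) {{>-nonZero 0<L}} (s≤s n≤k) ⟩
    suc k * length L                                                     ≡⟨ cong (suc k *_) (trans (sym (ℕₚ.*-identityʳ _)) (sym (∑-const L 1))) ⟩
    suc k * (∑[ _ ∈ L ] 1)                                               ≤⟨ *-monoʳ-≤ (suc k) (∑-mono-∈ L bad) ⟩
    suc k * (∑[ x ∈ L ] ∑[ i ∈ allFin n ] ⟨ ¬? (P? i x) ⟩)               ≡⟨ cong (suc k *_) (∑-swap L (allFin n) _) ⟩
    suc k * (∑[ i ∈ allFin n ] ∑[ x ∈ L ] ⟨ ¬? (P? i x) ⟩)               ≡⟨ ∑-*ˡ (allFin n) (suc k) _ ⟨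
    ∑[ i ∈ allFin n ] (suc k * (∑[ x ∈ L ] ⟨ ¬? (P? i x) ⟩))             ≤⟨ ∑-mono (allFin n) few ⟩
    ∑[ _ ∈ allFin n ] length L                                           ≡⟨ trans (∑-const (allFin n) _) (cong (_* length L) {y = n} (length-tabulate (λ i → i))) ⟩
    n * length L                                                         ∎))
    where
    open ≤-Reasoning
    bad : ∀ {x} → x ∈ L → 1 ≤ ∑[ i ∈ allFin n ] ⟨ ¬? (P? i x) ⟩
    bad {x} x∈L with ¬∀⟶∃¬ n _ (λ i → P? i x) (λ ∀P → ¬p (Any.map (λ { refl → ∀P }) x∈L))
    ... | i , ¬Pi = ≤-trans (≤-reflexive (sym (⟨⟩-yes (¬? (P? i x)) ¬Pi))) (∑-∈-≤ (λ i → ⟨ ¬? (P? i x) ⟩) (∈-allFin i))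

  -- The number of values left when two residue classes are excluded.
  ω : ℕ
  ω = size ∸ 2 * μ

  Avoids : Carrier → Carrier → Carrier → Set
  Avoids τ τ′ t = ¬ t ~ τ × ¬ t ~ τ′

  avoids? : ∀ τ τ′ → Decidable₁ (Avoids τ τ′)
  avoids? τ τ′ t = ¬? (t ~? τ) ×-dec ¬? (t ~? τ′)

  elems-distinct : AllPairs (λ x y → ¬ x ≈ y) elems
  elems-distinct = AllPairsP.map⁺ (AllPairs.map (λ i≢j ei≈ej → i≢j (enum-inj _ _ ei≈ej)) (allFin⁺ size))

  ω≤avoiding : ∀ τ τ′ → ω ≤ length (filter (avoids? τ τ′) elems)
  ω≤avoiding τ τ′ = ℕₚ.m≤n+o⇒m∸n≤o size (2 * μ) (begin
    size
      ≡⟨ trans (sym (ℕₚ.*-identityʳ size)) (sym (∑-elems-const 1)) ⟩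
    ∑[ _ ∈ elems ] 1
      ≤⟨ ∑-mono elems cover ⟩
    ∑[ t ∈ elems ] ((⟨ t ~? τ ⟩ + ⟨ t ~? τ′ ⟩) + ⟨ avoids? τ τ′ t ⟩)
      ≡⟨ trans (∑-+ elems _ _) (cong (_+ ∑ elems (λ t → ⟨ avoids? τ τ′ t ⟩)) (∑-+ elems _ _)) ⟩
    (∑ elems (λ t → ⟨ t ~? τ ⟩) + ∑ elems (λ t → ⟨ t ~? τ′ ⟩)) + ∑ elems (λ t → ⟨ avoids? τ τ′ t ⟩)
      ≡⟨ cong₂ _+_ (cong₂ _+_ (∑-residueClass τ) (trans (∑-residueClass τ′) (sym (ℕₚ.+-identityʳ μ))))
                   (sym (length-filter-∑ (avoids? τ τ′) elems)) ⟩
    2 * μ + length (filter (avoids? τ τ′) elems) ∎)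
    where
    open ≤-Reasoning
    cover : ∀ t → 1 ≤ (⟨ t ~? τ ⟩ + ⟨ t ~? τ′ ⟩) + ⟨ avoids? τ τ′ t ⟩
    cover t with t ~? τ | t ~? τ′
    ... | yes _  | _       = s≤s z≤n
    ... | no _   | yes _   = s≤s z≤n
    ... | no _   | no _    = s≤s z≤n

  -- The two excluded classes of an entry do not depend on the other entries, so the choices
  -- multiply.
  admissibleRows : ∀ {n} (τ τ′ : Fin n → Carrier) →
    ∃ λ rows → All (λ ts → ∀ i → Avoids (τ i) (τ′ i) (lookup ts i)) rows ×
               AllPairs (λ ts ts′ → ¬ ts ≋ ts′) rows × ω ^ n ≤ length rows
  admissibleRows {zero}  τ τ′ = [] ∷ [] , (λ ()) ∷ [] , [] ∷ [] , s≤s z≤n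
  admissibleRows {suc n} τ τ′ with admissibleRows (τ ∘ suc) (τ′ ∘ suc)
  ... | rows , avoid , distinct , ω^n≤
    with gather (λ t ts → ∃ λ ts′ → ts ≡ t ∷ ts′ × (∀ i → Avoids (τ (suc i)) (τ′ (suc i)) (lookup ts′ i))) (ω ^ n)
           (λ { t≉ (_ , refl , _) (_ , refl , _) (t≈ ∷ _) → t≉ t≈ })
           (filter (avoids? (τ zero) (τ′ zero)) elems) (AllPairsP.filter⁺ (avoids? _ _) elems-distinct)
           (λ {t} _ → map (t ∷_) rows , AllP.map⁺ (All.map (λ {ts} p → ts , refl , p) avoid) ,
                      AllPairsP.map⁺ (AllPairs.map (λ ≉ p → ≉ (PW.tail p)) distinct) ,
                      ≤-trans ω^n≤ (≤-reflexive (sym (length-map (t ∷_) rows))))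
  ... | l , Ql , l# , len = l ,
    All.map (λ { (t , t∈ , ts′ , refl , p) → λ { zero → proj₂ (∈-filter⁻ (avoids? (τ zero) (τ′ zero)) {xs = elems} t∈) ; (suc i) → p i } }) Ql ,
    l# , ≤-trans (*-monoˡ-≤ (ω ^ n) (ω≤avoiding (τ zero) (τ′ zero))) len

  -- An explicit differing Gram entry, which survives a shift of indices when a further point is put
  -- in front.
  Separated : ∀ {d m} → Vec (Vec Carrier d) m → Vec (Vec Carrier d) m → Set
  Separated xs ys = ∃ λ i → ∃ λ j → ¬ (lookup xs i · lookup xs j ≈ lookup ys i · lookup ys j)

  ≋⁻ : ∀ {n} {x y : Vec Carrier n} → ¬ x ≋ y → ∃ λ i → ¬ lookup x i ≈ lookup y i
  ≋⁻ {n} {x} {y} x≉y = ¬∀⟶∃¬ n _ (λ i → lookup x i ≈? lookup y i) (x≉y ∘ extensional x y)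
    where
    extensional : ∀ {n} (x y : Vec Carrier n) → (∀ i → lookup x i ≈ lookup y i) → x ≋ y
    extensional []      []      h = []
    extensional (_ ∷ x) (_ ∷ y) h = h zero ∷ extensional x y (h ∘ suc)

  exclude-corner : ∀ {d j} (xs : Vec (Vec Carrier d) j) {a b} → κ.Nondeg xs a → κ.Nondeg xs b →
                   ∃ λ τ → ∀ {t} → ¬ t ~ τ → κ.Ker xs a b t
  exclude-corner xs {a} {b} = κ.exclude residueField-inverse xs
    (∃-vec? (λ c → κ.Gram xs c +ᵛ b ~ᵛ? 0ᵛ)
      (λ u≋v → κ.≋-trans (≋⇒~ᵛ (+ᵛ-cong (mul-cong xs (comb-cong (≋-sym u≋v))) ≋-refl))))
    where
    comb-cong : ∀ {c c′} → c ≋ c′ → comb c xs ≋ comb c′ xs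
    comb-cong {c} {c′} c≋c′ = x-y≋0⇒x≋y (≋-trans (≋-sym (comb-- c c′ xs)) (comb-≋0 xs (x≋y⇒x-y≋0 c≋c′)))

  -- Choosing the points one at a time

  module StepArithmetic where
    open +-*-Solver
    open ≤-Reasoning

    0<length : ∀ ε F l → 0 < ε → ε ≤ F * l → 0 < l
    0<length ε F zero    0<ε p = ⊥-elim (ℕₚ.<-irrefl refl (ℕₚ.<-≤-trans 0<ε (subst (ε ≤_) (*-zeroʳ F) p)))
    0<length ε F (suc l) 0<ε p = s≤s z≤n

    -- If the `m` discarded points account for at most half of `ε`, the rest accounts for the other
    -- half.
    halve : ∀ ε F l l′ m → ε ≤ F * l → l ≤ l′ + m → 2 * (F * m) ≤ ε → ε ≤ 2 * (F * l′)
    halve ε F l l′ m p q r = ℕₚ.+-cancelʳ-≤ ε _ _ (begin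
      ε + ε                          ≡⟨ cong (ε +_) (ℕₚ.+-identityʳ ε) ⟨
      2 * ε                          ≤⟨ *-monoʳ-≤ 2 (≤-trans p (*-monoʳ-≤ F q)) ⟩
      2 * (F * (l′ + m))             ≡⟨ solve 3 (λ F l m → con 2 :* (F :* (l :+ m)) := con 2 :* (F :* l) :+ con 2 :* (F :* m)) refl F l′ m ⟩
      2 * (F * l′) + 2 * (F * m)     ≤⟨ ℕₚ.+-monoʳ-≤ _ r ⟩
      2 * (F * l′) + ε               ∎)

    -- The loss `4 * N` of one step: 2 for discarding dependent points and `2 * N` for prescribing a
    -- dot product. Iterated, it gives the factor `4 ^ j * size ^ j` in the invariant `big`.
    shrink : ∀ ε F N β ν → ε ≤ 2 * (F * β) → β ≤ 2 * (N * ν) → ε ≤ 4 * N * F * ν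
    shrink ε F N β ν p q = begin
      ε                              ≤⟨ p ⟩
      2 * (F * β)                    ≤⟨ *-monoʳ-≤ 2 (*-monoʳ-≤ F q) ⟩
      2 * (F * (2 * (N * ν)))        ≡⟨ solve 3 (λ F N ν → con 2 :* (F :* (con 2 :* (N :* ν))) := con 4 :* N :* F :* ν) refl F N ν ⟩
      4 * N * F * ν                  ∎

    -- Turns Chebyshev's bound into the hypothesis of the union bound. Here `α` and `β` are the
    -- sizes of the candidate sets for the next point and for a later one; both are large, so
    -- `ε * ε` bounds their product from below. Everything is multiplied by the positive `c` to
    -- avoid quotients.
    few : ∀ ε f n k h T M α β X → 0 < ε → ε ≤ 2 * (f * n * α) → ε ≤ 2 * (f * n * β) → n * h ≤ M →
          16 * suc k * (f * f) * (n * (M * T)) ≤ ε * ε → β * X ≤ 4 * (h * T) → suc k * X ≤ α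
    few ε f n k h T M α β X 0<ε pα pβ nh≤M large cheb = ℕₚ.*-cancelˡ-≤ c {{>-nonZero 0<c}} (begin
      c * (suc k * X)                                         ≡⟨ solve 5 (λ f n β k X → con 4 :* (f :* n :* (f :* n)) :* β :* (k :* X)
                                                                   := con 4 :* (f :* n :* (f :* n)) :* k :* (β :* X)) refl f n β (suc k) X ⟩
      4 * (f * n * (f * n)) * suc k * (β * X)                 ≤⟨ *-monoʳ-≤ (4 * (f * n * (f * n)) * suc k) cheb ⟩
      4 * (f * n * (f * n)) * suc k * (4 * (h * T))           ≡⟨ solve 5 (λ f n k h T → con 4 :* (f :* n :* (f :* n)) :* k :* (con 4 :* (h :* T))
                                                                   := con 16 :* k :* (f :* f) :* (n :* ((n :* h) :* T))) refl f n (suc k) h T ⟩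
      16 * suc k * (f * f) * (n * ((n * h) * T))              ≤⟨ *-monoʳ-≤ (16 * suc k * (f * f)) (*-monoʳ-≤ n (*-monoˡ-≤ T nh≤M)) ⟩
      16 * suc k * (f * f) * (n * (M * T))                    ≤⟨ large ⟩
      ε * ε                                                   ≤⟨ ℕₚ.*-mono-≤ pβ pα ⟩
      2 * (f * n * β) * (2 * (f * n * α))                     ≡⟨ solve 4 (λ f n α β → con 2 :* (f :* n :* β) :* (con 2 :* (f :* n :* α))
                                                                   := con 4 :* (f :* n :* (f :* n)) :* β :* α) refl f n α β ⟩
      c * α                                                   ∎)
      where
      c = 4 * (f * n * (f * n)) * β
      0<F : 0 < f * n
      0<F = 0<length ε (2 * α) (f * n) 0<ε (≤-trans pα (≤-reflexive (swap α)))
        where swap : ∀ α → 2 * (f * n * α) ≡ 2 * α * (f * n)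
              swap α = trans (cong (2 *_) (ℕₚ.*-comm (f * n) α)) (sym (ℕₚ.*-assoc 2 α (f * n)))
      0<β : 0 < β
      0<β = 0<length ε (2 * (f * n)) β 0<ε (≤-trans pβ (≤-reflexive (sym (ℕₚ.*-assoc 2 (f * n) β))))
      0<c : 0 < c
      0<c = ℕₚ.*-mono-≤ (ℕₚ.*-mono-≤ {1} {4} (s≤s z≤n) (ℕₚ.*-mono-≤ 0<F 0<F)) 0<β

  -- `small` ensures that dependent points make up at most half of a candidate set, `large` that
  -- exceptional points make up at most a fraction 1 / (k+1) of it.
  module Search (d k ε : ℕ) (0<ε : 0 < ε)
    (small : ∀ j → j < k → 2 * (4 ^ j * size ^ j * μ ^ d) ≤ ε)
    (large : ∀ j → j < k → 16 * suc k * (4 ^ j * 4 ^ j) * (size ^ j * (size ^ d * torsion d)) ≤ ε * ε) where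

    -- The points xs are already chosen; the i-th of the remaining points is to be chosen in
    -- sets i, whose members have the prescribed dot products cols i with xs.
    record State (j n : ℕ) : Set where
      field
        xs            : Vec (Vec Carrier d) j
        sets          : Fin n → List (Vec Carrier d)
        cols          : Fin n → Vec Carrier j
        split         : Split xs
        few-solutions : ∀ a → size ^ j * solutions xs a ≤ size ^ d
        distinct      : ∀ i → IsFinSet R (sets i)
        sets-cols     : ∀ i {y} → y ∈ sets i → mul xs y ≋ cols i
        nondeg        : ∀ i → κ.Nondeg xs (cols i)
        big           : ∀ i → ε ≤ 4 ^ j * size ^ j * length (sets i)

    Tuples : ∀ {n} → (Fin n → List (Vec Carrier d)) → ℕ → Set
    Tuples {n} sets c = ∃ λ (l : List (Vec (Vec Carrier d) n)) →
      All (λ ys → ∀ i → lookup ys i ∈ sets i) l × AllPairs Separated l × c ≤ length l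

    module Step {j n} (j<k : j < k) (n<k : suc n ≤ k) (S : State j (suc (suc n))) where
      open State S

      indep : Fin (suc (suc n)) → List (Vec Carrier d)
      indep i = filter (independent? xs) (sets i)

      indep⁻ : ∀ i {y} → y ∈ indep i → y ∈ sets i × Independent xs y
      indep⁻ i = ∈-filter⁻ (independent? xs) {xs = sets i}

      indep-distinct : ∀ i → IsFinSet R (indep i)
      indep-distinct i = AllPairsP.filter⁺ (independent? xs) (distinct i)

      indep-big : ∀ i → ε ≤ 2 * (4 ^ j * size ^ j * length (indep i))
      indep-big i = StepArithmetic.halve ε (4 ^ j * size ^ j) (length (sets i)) (length (indep i)) (μ ^ d) (big i)
        (dependent-few xs split (nondeg i) (distinct i) (sets-cols i)) (small j j<k)

      -- The same two columns in both orders, giving a matrix and its transpose: avoiding `τ` serves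
      -- the second moment of this step, avoiding `τ′` the nondegeneracy required at the next. Two
      -- exclusions take the place of an argument on row and column rank.
      τ τ′ : Fin (suc n) → Carrier
      τ  i = proj₁ (exclude-corner xs (nondeg zero) (nondeg (suc i)))
      τ′ i = proj₁ (exclude-corner xs (nondeg (suc i)) (nondeg zero))

      module Row (ts : Vec Carrier (suc n)) (avoids : ∀ i → Avoids (τ i) (τ′ i) (lookup ts i)) where

        ker : ∀ i → κ.Ker xs (cols zero) (cols (suc i)) (lookup ts i)
        ker i = proj₂ (exclude-corner xs (nondeg zero) (nondeg (suc i))) (proj₁ (avoids i))

        ker′ : ∀ i → κ.Ker xs (cols (suc i)) (cols zero) (lookup ts i)
        ker′ i = proj₂ (exclude-corner xs (nondeg (suc i)) (nondeg zero)) (proj₂ (avoids i))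

        module Moment (i : Fin (suc n)) = SecondMoment xs split (ker i) (indep-distinct (suc i))
          (λ y∈ → proj₂ (indep⁻ (suc i) y∈)) (λ y∈ → sets-cols (suc i) (proj₁ (indep⁻ (suc i) y∈)))

        -- A single point must serve all remaining sets at once, since its dot products with all of
        -- them are prescribed together.
        chosen : ∃ λ x → x ∈ indep zero × (∀ i → length (indep (suc i)) ≤ 2 * (size * Moment.ν i x))
        chosen = choose (λ i x → length (indep (suc i)) ≤? 2 * (size * Moment.ν i x)) (indep zero)
          (StepArithmetic.0<length ε (2 * (4 ^ j * size ^ j)) (length (indep zero)) 0<ε
            (≤-trans (indep-big zero) (≤-reflexive (sym (ℕₚ.*-assoc 2 (4 ^ j * size ^ j) (length (indep zero)))))))
          n<k
          (λ i → StepArithmetic.few ε (4 ^ j) (size ^ j) k (solutions xs (cols zero)) (torsion d) (size ^ d)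
            (length (indep zero)) (length (indep (suc i))) _ 0<ε (indep-big zero) (indep-big (suc i))
            (few-solutions (cols zero)) (large j j<k)
            (Moment.exceptional-few i (indep-distinct zero) (λ x∈ → sets-cols zero (proj₁ (indep⁻ zero x∈)))))

        x : Vec Carrier d
        x = proj₁ chosen

        x∈ : x ∈ sets zero
        x∈ = proj₁ (indep⁻ zero (proj₁ (proj₂ chosen)))

        x-independent : Independent xs x
        x-independent = proj₂ (indep⁻ zero (proj₁ (proj₂ chosen)))

        next : Fin (suc n) → List (Vec Carrier d)
        next i = filter (λ y → y · x ≈? lookup ts i) (indep (suc i))

        next⁻ : ∀ i {y} → y ∈ next i → y ∈ indep (suc i) × y · x ≈ lookup ts i
        next⁻ i = ∈-filter⁻ (λ y → y · x ≈? lookup ts i) {xs = indep (suc i)}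

        nextState : State (suc j) (suc n)
        nextState = record
          { xs            = x ∷ xs
          ; sets          = next
          ; cols          = λ i → lookup ts i ∷ cols (suc i)
          ; split         = Split-∷ split x-independent
          ; few-solutions = λ { (t ∷ a) → ≤-trans (≤-reflexive (trans
                (trans (cong (_* solutions (x ∷ xs) (t ∷ a)) (ℕₚ.*-comm size (size ^ j))) (ℕₚ.*-assoc (size ^ j) size _))
                (cong (size ^ j *_) (solutions-∷ xs x-independent a t)))) (few-solutions a) }
          ; distinct      = λ i → AllPairsP.filter⁺ (λ y → y · x ≈? lookup ts i) (indep-distinct (suc i))
          ; sets-cols     = λ i {y} y∈ → let y∈′ , yx≈t = next⁻ i y∈ in
                ≈-trans (·-comm x y) yx≈t ∷ sets-cols (suc i) (proj₁ (indep⁻ (suc i) y∈′))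
          -- The new border is `cols (suc i)` with the value of the row on top, so the transposed
          -- condition is the one called for.
          ; nondeg        = λ i → κ.Nondeg-∷ (≋⇒~ᵛ (sets-cols zero x∈)) (ker′ i)
          ; big           = λ i → ≤-trans
                (StepArithmetic.shrink ε (4 ^ j * size ^ j) size (length (indep (suc i))) (Moment.ν i x)
                  (indep-big (suc i)) (proj₂ (proj₂ chosen) i))
                (≤-reflexive (cong₂ _*_ (interchange-* (4 ^ j) (size ^ j) size)
                  (sym (length-filter-∑ (λ y → y · x ≈? lookup ts i) (indep (suc i))))))
          }
          where
          interchange-* : ∀ f n N → 4 * N * (f * n) ≡ 4 * f * (N * n)
          interchange-* f n N = solve 3 (λ f n N → con 4 :* N :* (f :* n) := con 4 :* f :* (N :* n)) refl f n N
            where open +-*-Solver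

      module Extend (search : (S′ : State (suc j) (suc n)) → Tuples (State.sets S′) (ω ^ triangle n)) where

        admissible = admissibleRows τ τ′
        rows = proj₁ admissible

        Q : Vec Carrier (suc n) → Vec (Vec Carrier d) (suc (suc n)) → Set
        Q ts ys = (∀ i → lookup ys i ∈ sets i) × (∀ i → lookup ys (suc i) · lookup ys zero ≈ lookup ts i)

        separate : ∀ {ts ts′} ys ys′ → ¬ ts ≋ ts′ → Q ts ys → Q ts′ ys′ → Separated ys ys′
        separate ys ys′ ts≉ (_ , p) (_ , p′) = let i , ≉ = ≋⁻ ts≉ in
          suc i , zero , λ eq → ≉ (≈-trans (≈-sym (p i)) (≈-trans eq (p′ i)))

        -- The point `x` depends on the prescribed row `ts`. This is harmless: tuples of different
        -- rows are told apart by dot products with their respective first points, not by the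
        -- points.
        row : ∀ ts → (∀ i → Avoids (τ i) (τ′ i) (lookup ts i)) →
              ∃ λ l → All (Q ts) l × AllPairs Separated l × ω ^ triangle n ≤ length l
        row ts avoids = let l , inSets , l# , len = search nextState in
          map (x ∷_) l ,
          AllP.map⁺ (All.map (λ p → (λ { zero → x∈ ; (suc i) → proj₁ (indep⁻ (suc i) (proj₁ (next⁻ i (p i)))) }) ,
                                    (λ i → proj₂ (next⁻ i (p i)))) inSets) ,
          AllPairsP.map⁺ (AllPairs.map (λ (i , i′ , ≉) → suc i , suc i′ , ≉) l#) ,
          ≤-trans len (≤-reflexive (sym (length-map (x ∷_) l)))
          where open Row ts avoids

        extended : Tuples sets (ω ^ triangle (suc n))
        extended = let _ , avoid , rows-distinct , ω^≤ = admissible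
                       l , Ql , l# , len = gather Q (ω ^ triangle n) (λ {_} {_} {ys} {ys′} → separate ys ys′) rows rows-distinct
                                             (λ {ts} ts∈ → row ts (All.lookup avoid ts∈))
          in l , All.map (λ (_ , _ , p , _) → p) Ql , l# ,
             ≤-trans (≤-reflexive (^-distribˡ-+-* ω (suc n) (triangle n)))
               (≤-trans (*-monoˡ-≤ (ω ^ triangle n) ω^≤) len)

    search : ∀ n j → n + j ≡ k → (S : State j (suc n)) → Tuples (State.sets S) (ω ^ triangle n)
    search zero j _ S = let y , y∈ = member _ (StepArithmetic.0<length ε (4 ^ j * size ^ j) _ 0<ε (State.big S zero)) in
      (y ∷ []) ∷ [] , (λ { zero → y∈ }) ∷ [] , [] ∷ [] , s≤s z≤n
      where
      member : ∀ (L : List (Vec Carrier d)) → 0 < length L → ∃ λ y → y ∈ L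
      member (y ∷ L) _ = y , here refl
    search (suc n) j n+j≡k S = Step.Extend.extended
      (subst (suc j ≤_) n+j≡k (s≤s (m≤n+m j n))) (subst (suc n ≤_) n+j≡k (m≤m+n (suc n) j)) S
      (search n (suc j) (trans (ℕₚ.+-suc n j) n+j≡k))

    search-all : {E : List (Vec Carrier d)} → IsFinSet R E → ε ≤ length E → Tuples {suc k} (λ _ → E) (ω ^ triangle k)
    search-all {E} E! ε≤E = search k 0 (ℕₚ.+-identityʳ k) (record
      { xs = [] ; sets = λ _ → E ; cols = λ _ → [] ; split = Split-[]
      ; few-solutions = λ { [] → ≤-reflexive (trans (ℕₚ.*-identityˡ _) (∑-vecs-1 d)) }
      ; distinct = λ _ → E! ; sets-cols = λ _ _ → [] ; nondeg = λ { _ [] _ _ → [] }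
      ; big = λ _ → ≤-trans ε≤E (≤-reflexive (sym (ℕₚ.*-identityˡ _))) })

  -- From separated tuples to congruence classes

  ∈-tuples : {A : Set} {m : ℕ} (ys : Vec A m) {L : List A} → (∀ i → lookup ys i ∈ L) → ys ∈ tuples m L
  ∈-tuples []       h = here refl
  ∈-tuples (y ∷ ys) {L} h = ∈-concatMap⁺ (λ a → map (a ∷_) (tuples _ L)) (Any.map (λ { refl → ∈-map⁺ (y ∷_) (∈-tuples ys (h ∘ suc)) }) (h zero))

  -- Incidences between tuples and listed classes are counted twice: every tuple has its Gram matrix
  -- represented in the deduplicated list, and separated tuples cannot share a representative.
  separated-≤numClasses : ∀ {d k} {E : List (Vec Carrier d)} (l : List (Vec (Vec Carrier d) (suc k))) →
    All (λ ys → ∀ i → lookup ys i ∈ E) l → AllPairs Separated l → length l ≤ numClasses R k E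
  separated-≤numClasses {d} {k} {E} l l∈ l# = begin
    length l                                                ≡⟨ trans (sym (ℕₚ.*-identityʳ _)) (sym (∑-const l 1)) ⟩
    ∑[ _ ∈ l ] 1                                            ≤⟨ ∑-mono-∈ l represented ⟩
    ∑[ ys ∈ l ] ∑[ g ∈ classes ] ⟨ gramEq? (gram ys) g ⟩    ≡⟨ ∑-swap l classes _ ⟩
    ∑[ g ∈ classes ] ∑[ ys ∈ l ] ⟨ gramEq? (gram ys) g ⟩    ≤⟨ ∑-mono classes (λ g → ∑⟨⟩≤1 (λ ys → gramEq? (gram ys) g) l# (λ {ys} {ys′} → incongruent ys ys′)) ⟩
    ∑[ _ ∈ classes ] 1                                      ≡⟨ trans (∑-const classes 1) (ℕₚ.*-identityʳ _) ⟩
    length classes                                          ∎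
    where
    open ≤-Reasoning
    open FiniteValuationRing R using (gramEq?; gram; GramEq)
    classes = deduplicate gramEq? (map gram (tuples (suc k) E))
    gramEq-sym : ∀ {m} {g g′ : Vec (Vec Carrier m) m} → GramEq g g′ → GramEq g′ g
    gramEq-sym = PW.sym (PW.sym ≈-sym)
    gramEq-trans : ∀ {m} {g g′ g″ : Vec (Vec Carrier m) m} → GramEq g g′ → GramEq g′ g″ → GramEq g g″
    gramEq-trans = PW.trans (PW.trans ≈-trans)
    represented : ∀ {ys} → ys ∈ l → 1 ≤ ∑[ g ∈ classes ] ⟨ gramEq? (gram ys) g ⟩
    represented {ys} ys∈l with find (AnyP.deduplicate⁺ gramEq? {P = GramEq (gram ys)}
        (λ g≈ p → gramEq-trans p (gramEq-sym g≈))
        (Any.map (λ { refl → PW.refl (PW.refl ≈-refl) }) (∈-map⁺ gram (∈-tuples ys (All.lookup l∈ ys∈l)))))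
    ... | g , g∈ , eq = ≤-trans (≤-reflexive (sym (⟨⟩-yes (gramEq? (gram ys) g) eq))) (∑-∈-≤ (λ g → ⟨ gramEq? (gram ys) g ⟩) g∈)
    entry : ∀ {m} (ys : Vec (Vec Carrier d) m) i j → lookup (lookup (gram ys) i) j ≡ lookup ys i · lookup ys j
    entry ys i j = trans (cong (λ v → lookup v j) (VecP.lookup∘tabulate _ i)) (VecP.lookup∘tabulate _ j)
    incongruent : ∀ {g} ys ys′ → GramEq (gram ys) g → GramEq (gram ys′) g → ¬ Separated ys ys′
    incongruent ys ys′ p p′ (i , j , ≉) = ≉ (subst₂ _≈_ (entry ys i j) (entry ys′ i j)
      (PW.lookup (PW.lookup (gramEq-trans p (gramEq-sym p′)) i) j))

-- Numerical estimates

triangle≡C2 : ∀ k → triangle k ≡ suc k C 2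
triangle≡C2 zero    = refl
triangle≡C2 (suc k) = trans (cong₂ _+_ (sym (nC1≡n (suc k))) (triangle≡C2 k)) (nCk+nC[k+1]≡[n+1]C[k+1] (suc k) 1)

module Numerics where
  open +-*-Solver
  open ≤-Reasoning

  -- The 32 is the 16 of `few` times the 2 in the bound on the torsion; `suc k` comes from the union
  -- bound, and `16 ^ k` from squaring the loss `4 ^ j`.
  constant : ℕ → ℕ
  constant k = 32 * (suc k * 16 ^ k)

  0<^ : ∀ {b} n → 0 < b → 0 < b ^ n
  0<^ {suc b} n _ = m^n>0 (suc b) n

  constant≤square : ∀ k → constant k ≤ constant k * constant k
  constant≤square k = m≤m*n (constant k) (constant k)
    {{>-nonZero (*-mono-≤ {1} {32} (s≤s z≤n) (*-mono-≤ {1} {suc k} (s≤s z≤n) (0<^ k (s≤s z≤n))))}}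

  ^-distribʳ-* : ∀ j a b → (a * b) ^ j ≡ a ^ j * b ^ j
  ^-distribʳ-* zero    a b = refl
  ^-distribʳ-* (suc j) a b = trans (cong (a * b *_) (^-distribʳ-* j a b))
    (solve 4 (λ a b x y → a :* b :* (x :* y) := a :* x :* (b :* y)) refl a b (a ^ j) (b ^ j))

  16^≡ : ∀ j → 4 ^ j * 4 ^ j ≡ 16 ^ j
  16^≡ j = sym (^-distribʳ-* j 4 4)

  2*4^≤constant : ∀ k → 2 * 4 ^ k ≤ constant k
  2*4^≤constant k = *-mono-≤ {2} {32} (s≤s (s≤s z≤n))
    (≤-trans (^-monoˡ-≤ k (s≤s (s≤s (s≤s (s≤s z≤n))))) (m≤m+n (16 ^ k) _))

  module Threshold (q N μ L d k : ℕ) (0<q : 0 < q) (0<N : 0 < N) (N≡qμ : N ≡ q * μ) (L≤ : L ≤ N ^ d)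
    (threshold : constant (suc k) * constant (suc k) * (N ^ d * μ ^ d * (q * N ^ k)) ≤ L * L) where

    K = constant (suc k)

    instance
      N^d≢0 = >-nonZero (0<^ d 0<N)

    -- The hypothesis is quadratic in `L`, while discarding dependent points needs a linear bound;
    -- the trivial `L ≤ N ^ d` removes one factor.
    L-lower : K * K * (μ ^ d * (q * N ^ k)) ≤ L
    L-lower = *-cancelˡ-≤ (N ^ d) (begin
      N ^ d * (K * K * (μ ^ d * (q * N ^ k)))    ≡⟨ solve 4 (λ K a b c → a :* (K :* (b :* c)) := K :* (a :* b :* c)) refl (K * K) (N ^ d) (μ ^ d) (q * N ^ k) ⟩
      K * K * (N ^ d * μ ^ d * (q * N ^ k))      ≤⟨ threshold ⟩
      L * L                                      ≤⟨ *-monoˡ-≤ L L≤ ⟩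
      N ^ d * L                                  ∎)

    0<μ : 0 < μ
    0<μ = n≢0⇒n>0 (λ μ≡0 → <-irrefl refl (subst (0 <_) (trans N≡qμ (trans (cong (q *_) μ≡0) (*-zeroʳ q))) 0<N))

    0<L : 0 < L
    0<L = ≤-trans (*-mono-≤ (≤-trans (≤-trans (*-mono-≤ {1} {2} (s≤s z≤n) (0<^ (suc k) (s≤s z≤n))) (2*4^≤constant (suc k))) (constant≤square (suc k)))
                            (*-mono-≤ (0<^ d 0<μ) (*-mono-≤ 0<q (0<^ k 0<N)))) L-lower

    N^≤ : ∀ {j} → j < suc k → N ^ j ≤ N ^ k
    N^≤ (s≤s j≤k) = ^-monoʳ-≤ N {{>-nonZero 0<N}} j≤k

    small : ∀ j → j < suc k → 2 * (4 ^ j * N ^ j * μ ^ d) ≤ L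
    small j j<k = begin
      2 * (4 ^ j * N ^ j * μ ^ d)              ≤⟨ *-monoʳ-≤ 2 (*-monoˡ-≤ (μ ^ d) (*-mono-≤ (^-monoʳ-≤ 4 (<⇒≤ j<k)) (N^≤ j<k))) ⟩
      2 * (4 ^ suc k * N ^ k * μ ^ d)          ≡⟨ solve 3 (λ f n m → con 2 :* (f :* n :* m) := con 2 :* f :* (m :* n)) refl (4 ^ suc k) (N ^ k) (μ ^ d) ⟩
      2 * 4 ^ suc k * (μ ^ d * N ^ k)          ≤⟨ *-mono-≤ (≤-trans (2*4^≤constant (suc k)) (constant≤square (suc k)))
                                                    (*-monoʳ-≤ (μ ^ d) (m≤n*m (N ^ k) q {{>-nonZero 0<q}})) ⟩
      K * K * (μ ^ d * (q * N ^ k))            ≤⟨ L-lower ⟩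
      L                                        ∎

    large : ∀ T → T ≤ 2 * (q * μ ^ d) → ∀ j → j < suc k →
            16 * suc (suc k) * (4 ^ j * 4 ^ j) * (N ^ j * (N ^ d * T)) ≤ L * L
    large T T≤ j j<k = begin
      16 * suc (suc k) * (4 ^ j * 4 ^ j) * (N ^ j * (N ^ d * T))
        ≡⟨ cong (λ f → 16 * suc (suc k) * f * (N ^ j * (N ^ d * T))) (16^≡ j) ⟩
      16 * suc (suc k) * 16 ^ j * (N ^ j * (N ^ d * T))
        ≤⟨ *-mono-≤ (*-monoʳ-≤ (16 * suc (suc k)) (^-monoʳ-≤ 16 (<⇒≤ j<k)))
                    (*-mono-≤ (N^≤ j<k) (*-monoʳ-≤ (N ^ d) T≤)) ⟩
      16 * suc (suc k) * 16 ^ suc k * (N ^ k * (N ^ d * (2 * (q * μ ^ d))))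
        ≡⟨ solve 6 (λ s f n D q m → con 16 :* s :* f :* (n :* (D :* (con 2 :* (q :* m))))
                      := con 32 :* (s :* f) :* (D :* m :* (q :* n))) refl (suc (suc k)) (16 ^ suc k) (N ^ k) (N ^ d) q (μ ^ d) ⟩
      K * (N ^ d * μ ^ d * (q * N ^ k))
        ≤⟨ *-monoˡ-≤ _ (constant≤square (suc k)) ⟩
      K * K * (N ^ d * μ ^ d * (q * N ^ k))
        ≤⟨ threshold ⟩
      L * L ∎

    -- For `d ≡ 1` the threshold would make the set larger than the ring. So the torsion bound is
    -- called only for exponents from 2 on.
    d≢1 : ¬ (d ≡ 1)
    d≢1 refl = <-irrefl refl (begin-strict
      N                              <⟨ m<m*n N K {{>-nonZero 0<N}} (≤-trans (*-mono-≤ {2} {2} ≤-refl (0<^ (suc k) (s≤s z≤n))) (2*4^≤constant (suc k))) ⟩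
      N * K                          ≤⟨ *-mono-≤ (m≤m*n N (N ^ k) {{>-nonZero (0<^ k 0<N)}}) (constant≤square (suc k)) ⟩
      N * N ^ k * (K * K)            ≡⟨ cong (λ n → n * N ^ k * (K * K)) N≡qμ ⟩
      q * μ * N ^ k * (K * K)        ≡⟨ solve 4 (λ q μ n K → q :* μ :* n :* K := K :* (μ :* con 1 :* (q :* n))) refl q μ (N ^ k) (K * K) ⟩
      K * K * (μ ^ 1 * (q * N ^ k))  ≤⟨ L-lower ⟩
      L                              ≤⟨ L≤ ⟩
      N * 1                          ≡⟨ ℕₚ.*-identityʳ N ⟩
      N                              ∎)

  -- The exponent of the theorem regrouped by origin: the number of vectors, the maximal ideal to
  -- the power of the dimension together with q from the torsion, and one factor `q ^ suc r`, the
  -- size of the ring, for each step before the last.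
  exponents : ∀ q d r k → q ^ (d * (2 * suc r ∸ 1) + suc r * (suc k + 1))
            ≡ (q ^ suc r) ^ suc d * (q ^ r) ^ suc d * (q * (q ^ suc r) ^ k)
  exponents q d r k = begin-equality
    q ^ (d * (r + suc (r + 0)) + suc r * (suc k + 1))
      ≡⟨ cong (q ^_) (solve 3 (λ d r k → d :* (r :+ (con 1 :+ (r :+ con 0))) :+ (con 1 :+ r) :* ((con 1 :+ k) :+ con 1)
           := (con 1 :+ r) :* (con 1 :+ d) :+ r :* (con 1 :+ d) :+ (con 1 :+ (con 1 :+ r) :* k)) refl d r k) ⟩
    q ^ (suc r * suc d + r * suc d + suc (suc r * k))
      ≡⟨ ^-distribˡ-+-* q (suc r * suc d + r * suc d) (suc (suc r * k)) ⟩
    q ^ (suc r * suc d + r * suc d) * (q * q ^ (suc r * k))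
      ≡⟨ cong₂ (λ a b → a * (q * b)) (trans (^-distribˡ-+-* q (suc r * suc d) (r * suc d))
           (cong₂ _*_ (sym (^-*-assoc q (suc r) (suc d))) (sym (^-*-assoc q r (suc d))))) (sym (^-*-assoc q (suc r) k)) ⟩
    (q ^ suc r) ^ suc d * (q ^ r) ^ suc d * (q * (q ^ suc r) ^ k) ∎

  -- Bernoulli's inequality (1 - 2/q)^n ≥ 1 - 2n/q for q = p + 2, cleared of denominators.
  bernoulli : ∀ p n → (2 + p) * (2 + p) ^ n ≤ (2 + p) * p ^ n + 2 * n * (2 + p) ^ n
  bernoulli p zero    = m≤m+n _ _
  bernoulli p (suc n) = begin
    q * (q * q ^ n)                                  ≤⟨ *-monoʳ-≤ q (bernoulli p n) ⟩
    q * (q * p ^ n + 2 * n * q ^ n)                  ≡⟨ solve 4 (λ p x n y → (con 2 :+ p) :* ((con 2 :+ p) :* x :+ con 2 :* n :* y)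
                                                          := ((con 2 :+ p) :* (p :* x) :+ con 2 :* n :* ((con 2 :+ p) :* y)) :+ con 2 :* ((con 2 :+ p) :* x))
                                                          refl p (p ^ n) n (q ^ n) ⟩
    q * p ^ suc n + 2 * n * q ^ suc n + 2 * (q * p ^ n)
                                                     ≤⟨ +-monoʳ-≤ (q * p ^ suc n + 2 * n * q ^ suc n) (*-monoʳ-≤ 2 (*-monoʳ-≤ q (^-monoˡ-≤ n (m≤n+m p 2)))) ⟩
    q * p ^ suc n + 2 * n * q ^ suc n + 2 * q ^ suc n
                                                     ≡⟨ solve 3 (λ a n y → a :+ con 2 :* n :* y :+ con 2 :* y := a :+ con 2 :* (con 1 :+ n) :* y)
                                                          refl (q * p ^ suc n) n (q ^ suc n) ⟩
    q * p ^ suc n + 2 * suc n * q ^ suc n            ∎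
    where q = 2 + p

  -- Once 2n/q ≤ 1/(m+1), Bernoulli's inequality leaves at least the fraction m/(m+1) of all value
  -- patterns.
  most : ∀ m p n → suc m * (2 * n) ≤ 2 + p → m * (2 + p) ^ n ≤ suc m * p ^ n
  most m p n Q≤q = *-cancelˡ-≤ q (+-cancelʳ-≤ (q * q ^ n) _ _ (begin
    q * (m * q ^ n) + q * q ^ n                       ≡⟨ solve 3 (λ q m x → q :* (m :* x) :+ q :* x := (con 1 :+ m) :* (q :* x)) refl q m (q ^ n) ⟩
    suc m * (q * q ^ n)                               ≤⟨ *-monoʳ-≤ (suc m) (bernoulli p n) ⟩
    suc m * (q * p ^ n + 2 * n * q ^ n)               ≡⟨ solve 5 (λ q m x c y → m :* (q :* x :+ c :* y) := q :* (m :* x) :+ m :* c :* y) refl q (suc m) (p ^ n) (2 * n) (q ^ n) ⟩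
    q * (suc m * p ^ n) + suc m * (2 * n) * q ^ n     ≤⟨ +-monoʳ-≤ (q * (suc m * p ^ n)) (*-monoˡ-≤ (q ^ n) Q≤q) ⟩
    q * (suc m * p ^ n) + q * q ^ n                   ∎))
    where q = 2 + p

  most-scaled : ∀ m q μ N n M → 2 + suc m * (2 * n) ≤ q → N ≡ q * μ → (N ∸ 2 * μ) ^ n ≤ M → m * N ^ n ≤ suc m * M
  most-scaled m (suc (suc p)) μ _ n M (s≤s (s≤s Q≤)) refl ω≤M = begin
    m * (q * μ) ^ n                ≡⟨ cong (m *_) (^-distribʳ-* n q μ) ⟩
    m * (q ^ n * μ ^ n)            ≡⟨ ℕₚ.*-assoc m (q ^ n) (μ ^ n) ⟨
    m * q ^ n * μ ^ n              ≤⟨ *-monoˡ-≤ (μ ^ n) (most m p n (≤-trans Q≤ (m≤n+m p 2))) ⟩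
    suc m * p ^ n * μ ^ n          ≡⟨ ℕₚ.*-assoc (suc m) (p ^ n) (μ ^ n) ⟩
    suc m * (p ^ n * μ ^ n)        ≡⟨ cong (suc m *_) (^-distribʳ-* n p μ) ⟨
    suc m * (p * μ) ^ n            ≡⟨ cong (λ b → suc m * b ^ n) (*-distribʳ-∸ μ q 2) ⟩
    suc m * (q * μ ∸ 2 * μ) ^ n    ≤⟨ *-monoʳ-≤ (suc m) ω≤M ⟩
    suc m * M                      ∎
    where q = 2 + p

-- Assembling the bound

open Numerics

module _ (R : FiniteValuationRing) where
  open FiniteValuationRing R using (Carrier; size; residueCard)
  open ValuationRing R using (μ; torsion; torsion-≤; size≡q*μ; length≤; ω; module Search; separated-≤numClasses)

  numClasses-≥ : ∀ {d k} → 0 < residueCard → 0 < size → {E : List (Vec Carrier d)} → IsFinSet R E → 0 < d →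
    constant (suc k) * constant (suc k) * (size ^ d * μ ^ d * (residueCard * size ^ k)) ≤ length E * length E →
    ω ^ triangle (suc k) ≤ numClasses R (suc k) E
  numClasses-≥ {suc zero} {k} 0<q 0<N {E} E! _ threshold =
    ⊥-elim (Threshold.d≢1 residueCard size μ (length E) 1 k 0<q 0<N size≡q*μ (length≤ E!) threshold refl)
  numClasses-≥ {suc (suc e)} {k} 0<q 0<N {E} E! _ threshold =
    let l , l∈ , l# , len = Search.search-all (2 + e) (suc k) (length E) 0<L small
                              (large (torsion (2 + e)) torsion≤) E! ≤-refl
    in ≤-trans len (separated-≤numClasses l l∈ l#)
    where
    open Threshold residueCard size μ (length E) (2 + e) k 0<q 0<N size≡q*μ (length≤ E!) threshold
    rearrange : ∀ q μ e → 2 * (μ * (q * μ)) * e ≡ 2 * (q * (μ * (μ * e)))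
    rearrange = solve 3 (λ q μ e → con 2 :* (μ :* (q :* μ)) :* e := con 2 :* (q :* (μ :* (μ :* e)))) refl
      where open +-*-Solver
    torsion≤ : torsion (2 + e) ≤ 2 * (residueCard * μ ^ (2 + e))
    torsion≤ = ≤-trans (torsion-≤ e) (≤-reflexive
      (trans (cong (λ n → 2 * (μ * n) * μ ^ e) size≡q*μ) (rearrange residueCard μ (μ ^ e))))

  μ≡q^ : ∀ r → 0 < residueCard → size ≡ residueCard ^ suc r → μ ≡ residueCard ^ r
  μ≡q^ r 0<q size≡ = *-cancelˡ-≡ _ _ residueCard {{>-nonZero 0<q}} (trans (sym size≡q*μ) size≡)

-- The size hypothesis is squared because its exponent is a half-integer in general. The factor 1 -
-- o(1) becomes (m-1)/m for every m and all q from some Q on; the constant `K` is fixed before m.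
theorem1p2 : (d k r : ℕ) → 1 ≤ d → 1 ≤ k → 1 ≤ r →
    ∃ λ (K : ℕ) → (m : ℕ) → 1 ≤ m → ∃ λ (Q : ℕ) →
    (R : FiniteValuationRing) → (q : ℕ) →
    q ≡ FiniteValuationRing.residueCard R →
    (∃ λ p → ∃ λ n → Prime p × p % 2 ≡ 1 × 1 ≤ n × q ≡ p ^ n) →
    FiniteValuationRing.size R ≡ q ^ r →
    Q ≤ q →
    (E : List (Vec (FiniteValuationRing.Carrier R) d)) → IsFinSet R E →
    (K * K) * q ^ ((d ∸ 1) * (2 * r ∸ 1) + r * (k + 1)) ≤ length E * length E →
    (m ∸ 1) * q ^ (r * ((k + 1) C 2)) ≤ m * numClasses R k E
theorem1p2 (suc d) (suc k) (suc r) _ _ _ = constant (suc k) , λ where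
  -- The second summand is what Bernoulli's inequality asks of q; the summand 2 allows q to be
  -- written as p + 2 when two residue classes are removed.
  (suc m) _ → 2 + suc m * (2 * triangle (suc k)) , λ where
    R q refl _ size≡ Q≤q E E! threshold →
      let open FiniteValuationRing R using (size)
          open ValuationRing R using (μ; size≡q*μ)
          0<q = ≤-trans (s≤s z≤n) Q≤q
          exponents≡ = trans (exponents q d r k)
            (cong₂ (λ N μ → N ^ suc d * μ ^ suc d * (q * N ^ k)) (sym size≡) (sym (μ≡q^ R r 0<q size≡)))
          classes≥ = numClasses-≥ R {k = k} 0<q (subst (0 <_) (sym size≡) (0<^ (suc r) 0<q)) E! (s≤s z≤n)
            (subst (λ W → constant (suc k) * constant (suc k) * W ≤ length E * length E) exponents≡ threshold)
      in subst (λ W → m * W ≤ suc m * numClasses R (suc k) E)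
           (trans (cong₂ _^_ size≡ (trans (triangle≡C2 (suc k)) (cong (_C 2) (sym (ℕₚ.+-comm (suc k) 1)))))
                  (^-*-assoc q (suc r) ((suc k + 1) C 2)))
           (most-scaled m q μ size (triangle (suc k)) (numClasses R (suc k) E) Q≤q size≡q*μ classes≥)
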